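{- For every fixed positive integer $c$, there is a (polynomial-time) $2^{c-1}P(c)$-approximation algorithm for $c$-Load Coloring, where $P(c)=\prod_{i=1}^{c}\frac{K(i)}{i}$, $K(1)=1$, and $K(i)=16i^2-6i$ for $i\ge 2$.
   Context: Graphs are finite, simple and undirected; $[c]=\{1,\dots,c\}$. For a positive integer $c$, a nonnegative integer $k$ and a graph $G=(V,E)$, write $G\in(c,k)$-LCP if there is a map $\varphi:V\to[c]$ such that for every $i\in[c]$ at least $k$ edges have both endvertices colored $i$. $c$-Load Coloring (optimization problem): given a graph $G$, determine the maximum $k$, denoted $k_{opt}$, such that $G\in(c,k)$-LCP. The approximation ratio of an algorithm that outputs a value $k$ with $G\in(c,k)$-LCP is $k_{opt}/k$; thus an $r$-approximation algorithm is a polynomial-time algorithm (for fixed $c$) that, on every input $G$, outputs $k$ with $G\in (c,k)$-LCP and $k_{opt}\le r\cdot k$. -}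

module Defs where

open import Data.Bool.Base using (Bool; false; if_then_else_)
open import Data.Bool.Properties using (T?)
open import Data.Fin.Base as Fin using (Fin; fromℕ<; remQuot)
import Data.Fin.Properties as Fin
open import Data.Integer.Base as ℤ using (ℤ; +_)
open import Data.List.Base using (List; allFin; cartesianProduct; filter; length)
open import Data.List.Properties using (filter-≐; length-filter)
open import Data.Nat.Base using (ℕ; zero; suc; _+_; _*_; _∸_; _^_; _≤_; z≤n; NonZero)
open import Data.Nat.Properties
  using (_≟_; _≤?_; _<?_; ≤-trans; ≤∧≢⇒<; m<1+n⇒m≤n)
open import Data.Product.Base using (Σ; ∃; ∃-syntax; _×_; _,_; proj₁; proj₂; uncurry)
open import Data.Rational.Base as ℚ using (ℚ; 1ℚ)
open import Data.Vec.Functional using (Vector; []; _∷_; head; tail)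
open import Function.Base using (_∘_; const)
open import Level using (0ℓ)
open import Relation.Binary.PropositionalEquality
  using (_≡_; refl; sym; trans; cong; subst; _≗_)
open import Relation.Nullary using (¬_; Dec; yes; no)
open import Relation.Nullary.Decidable using (_×-dec_; map′)
open import Relation.Unary using (Pred; Decidable)

record Graph (n : ℕ) : Set where
  field
    adj    : Fin n → Fin n → Bool
    symm   : ∀ u v → adj u v ≡ adj v u
    irrefl : ∀ v → adj v v ≡ false

open Graph public

-- Each edge {u , v} is listed once, as the pair with u < v.

edges : ∀ {n} → Graph n → List (Fin n × Fin n)
edges {n} G =
  filter (λ (u , v) → u Fin.<? v ×-dec T? (adj G u v))
         (cartesianProduct (allFin n) (allFin n))

module _ {c n : ℕ} (φ : Fin n → Fin c) (i : Fin c) where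

  Mono : Pred (Fin n × Fin n) 0ℓ
  Mono (u , v) = φ u ≡ i × φ v ≡ i

  mono? : Decidable Mono
  mono? (u , v) = φ u Fin.≟ i ×-dec φ v Fin.≟ i

load : ∀ {c n} → Graph n → (Fin n → Fin c) → Fin c → ℕ
load G φ i = length (filter (mono? φ i) (edges G))

LCP : (c k : ℕ) → ∀ {n} → Graph n → Set
LCP c k {n} G = Σ (Fin n → Fin c) λ φ → ∀ i → k ≤ load G φ i

IsMaxLoad : (c : ℕ) → ∀ {n} → Graph n → ℕ → Set
IsMaxLoad c G m = LCP c m G × (∀ k → LCP c k G → k ≤ m)

load-cong : ∀ {c n} (G : Graph n) {φ ψ : Fin n → Fin c} → φ ≗ ψ →
            ∀ i → load G φ i ≡ load G ψ i
load-cong G {φ} {ψ} φ≗ψ i = cong length (filter-≐ (mono? φ i) (mono? ψ i)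
  ( (λ {(u , v)} (p , q) → trans (sym (φ≗ψ u)) p , trans (sym (φ≗ψ v)) q)
  , (λ {(u , v)} (p , q) → trans (φ≗ψ u) p , trans (φ≗ψ v) q)) (edges G))

anyVector? : ∀ {c} n {P : Pred (Vector (Fin c) n) 0ℓ} →
             (∀ {f g} → f ≗ g → P f → P g) → Decidable P → Dec (∃ P)
anyVector? zero    resp P? = map′ (λ p → [] , p) (λ (f , p) → resp (λ ()) p) (P? [])
anyVector? (suc n) resp P? = map′
  (λ (x , f , p) → x ∷ f , p)
  (λ (f , p) → head f , tail f
             , resp (λ { Fin.zero → refl ; (Fin.suc _) → refl }) p)
  (Fin.any? λ x → anyVector? n
    (λ f≗g → resp λ { Fin.zero → refl ; (Fin.suc j) → f≗g j })
    (P? ∘ (x ∷_)))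

LCP? : ∀ c k {n} (G : Graph n) → Dec (LCP c k G)
LCP? c k {n} G = anyVector? n
  (λ f≗g p i → subst (k ≤_) (load-cong G f≗g i) (p i))
  (λ φ → Fin.all? λ i → k ≤? load G φ i)

maxLoad : ∀ c .{{_ : NonZero c}} {n} (G : Graph n) → ∃ (IsMaxLoad c G)
maxLoad (suc c) G = search (length (edges G)) bound
  where
  bound : ∀ k → LCP (suc c) k G → k ≤ length (edges G)
  bound k (φ , p) =
    ≤-trans (p Fin.zero) (length-filter (mono? φ Fin.zero) (edges G))

  search : ∀ b → (∀ k → LCP (suc c) k G → k ≤ b) → ∃ (IsMaxLoad (suc c) G)
  search zero    ub = zero , (const Fin.zero , λ _ → z≤n) , ub
  search (suc b) ub with LCP? (suc c) (suc b) G
  ... | yes p = suc b , p , ub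
  ... | no ¬p = search b λ k q → m<1+n⇒m≤n
                  (≤∧≢⇒< (ub k q) λ { refl → ¬p q })

kₒₚₜ : ∀ c .{{_ : NonZero c}} {n} → Graph n → ℕ
kₒₚₜ c G = proj₁ (maxLoad c G)

-- Structured programs for a random access machine with
-- addition and truncated subtraction, but without multiplication.  An
-- operation increases the bit length of the largest number around by at
-- most one, so unit cost per operation yields the same polynomial-time
-- class as Turing machines; unit-cost multiplication would not.

data Expr : Set where
  lit     : ℕ → Expr
  reg     : ℕ → Expr
  mem     : Expr → Expr
  _⊕_ _⊖_ : Expr → Expr → Expr

infixl 6 _⊕_ _⊖_

data Program : Set where
  skip      : Program
  _:=_      : ℕ → Expr → Program
  mem[_]:=_ : Expr → Expr → Program
  _⨾_       : Program → Program → Program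
  ifnz      : Expr → Program → Program → Program
  while     : Expr → Program → Program

infix  4 _:=_ mem[_]:=_
infixr 3 _⨾_

record Store : Set where
  constructor store
  field
    regs  : ℕ → ℕ
    cells : ℕ → ℕ

open Store public

_[_↦_] : (ℕ → ℕ) → ℕ → ℕ → (ℕ → ℕ)
(f [ a ↦ x ]) b with a ≟ b
... | yes _ = x
... | no  _ = f b

⟦_⟧ : Expr → Store → ℕ
⟦ lit x ⟧ σ = x
⟦ reg r ⟧ σ = regs σ r
⟦ mem e ⟧ σ = cells σ (⟦ e ⟧ σ)
⟦ e ⊕ f ⟧ σ = ⟦ e ⟧ σ + ⟦ f ⟧ σ
⟦ e ⊖ f ⟧ σ = ⟦ e ⟧ σ ∸ ⟦ f ⟧ σ

cost : Expr → ℕ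
cost (lit _) = 1
cost (reg _) = 1
cost (mem e) = suc (cost e)
cost (e ⊕ f) = suc (cost e + cost f)
cost (e ⊖ f) = suc (cost e + cost f)

-- p , σ ⇓ τ , t : started in σ, the program p halts in τ after t steps.

infix 2 _,_⇓_,_

data _,_⇓_,_ : Program → Store → Store → ℕ → Set where
  ⇓skip   : ∀ {σ} → skip , σ ⇓ σ , 1
  ⇓assign : ∀ {r e σ} →
            (r := e) , σ ⇓ store (regs σ [ r ↦ ⟦ e ⟧ σ ]) (cells σ) , suc (cost e)
  ⇓write  : ∀ {a e σ} →
            (mem[ a ]:= e) , σ ⇓ store (regs σ) (cells σ [ ⟦ a ⟧ σ ↦ ⟦ e ⟧ σ ])
                           , suc (cost a + cost e)
  ⇓seq    : ∀ {p q σ τ υ s t} → p , σ ⇓ τ , s → q , τ ⇓ υ , t →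
            (p ⨾ q) , σ ⇓ υ , s + t
  ⇓then   : ∀ {e p q σ τ t} → ¬ ⟦ e ⟧ σ ≡ 0 → p , σ ⇓ τ , t →
            ifnz e p q , σ ⇓ τ , suc (cost e + t)
  ⇓else   : ∀ {e p q σ τ t} → ⟦ e ⟧ σ ≡ 0 → q , σ ⇓ τ , t →
            ifnz e p q , σ ⇓ τ , suc (cost e + t)
  ⇓loop   : ∀ {e p σ τ υ s t} → ¬ ⟦ e ⟧ σ ≡ 0 →
            p , σ ⇓ τ , s → while e p , τ ⇓ υ , t →
            while e p , σ ⇓ υ , suc (cost e + s + t)
  ⇓exit   : ∀ {e p σ} → ⟦ e ⟧ σ ≡ 0 →
            while e p , σ ⇓ σ , suc (cost e)

-- A graph on n vertices is presented as the number n in register 0 and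
-- its adjacency matrix in the memory, row by row: cell n * u + v holds 1
-- if u and v are adjacent and 0 otherwise.

adjacencyMatrix : ∀ {n} → Graph n → ℕ → ℕ
adjacencyMatrix {n} G a with a <? n * n
... | yes a<n² = if uncurry (adj G) (remQuot n (fromℕ< a<n²)) then 1 else 0
... | no  _    = 0

input : ∀ {n} → Graph n → Store
input {n} G = store (const 0 [ 0 ↦ n ]) (adjacencyMatrix G)

-- The result is read off from register 0.

Outputs_Within : Program → ∀ {n} → Graph n → ℕ → ℕ → Set
Outputs_Within p G k b =
  ∃[ τ ] ∃[ t ] (p , input G ⇓ τ , t) × regs τ 0 ≡ k × t ≤ b

fromℕ : ℕ → ℚ
fromℕ m = + m ℚ./ 1

-- The running time is bounded by a polynomial in the number n of
-- vertices, hence in the length of the input, and conversely.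

IsApproximationAlgorithm : (c : ℕ) .{{_ : NonZero c}} → ℚ → Program → Set
IsApproximationAlgorithm c r p =
  ∃[ a ] ∃[ d ] ∃[ b ] ∀ {n} (G : Graph n) →
    ∃[ k ] Outputs_Within p G k (a * n ^ d + b)
         × LCP c k G
         × fromℕ (kₒₚₜ c G) ℚ.≤ r ℚ.* fromℕ k

-- K is only used at positive arguments.

K : ℕ → ℤ
K 1 = + 1
K i = + 16 ℤ.* + (i ^ 2) ℤ.- + 6 ℤ.* + i

P : ℕ → ℚ
P zero    = 1ℚ
P (suc c) = P c ℚ.* (K (suc c) ℚ./ suc c)

{-# OPTIONS --safe #-}
module Submission where

-- Vertices are numbered, and the candidate colourings give each of the
-- colours 1 , … , c - 1 two windows of consecutive vertices, higher colours
-- overwriting lower ones.  Such a colouring is described by 4 (c - 1) numbers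
-- ≤ n, so that all of them can be tried in polynomial time.  That the best
-- one is r(c)-approximate, where r(c) = (32 c - 12) r(c - 1) and r(1) = 1, is
-- shown by induction on c, for a graph with m edges.
--
-- If k_opt ≤ r(c), it suffices to colour c disjoint edges, and a window may
-- consist of a single vertex.  Otherwise, if some vertex x has degree greater
-- than m / 6c, colour G - x with c - 1 colours and cut the neighbourhood of x
-- into 3c - 2 windows.  An old colour can lose more than half of its edges to
-- at most three of them, so one window is harmless to all of the old colours,
-- and together with x it receives the new colour.  If all degrees are at most
-- m / 6c, cut the vertices into 6c windows of about the same volume.  Some
-- pair of windows contains a fraction of at least 1 / 18c² of the edges not
-- yet spoilt; it receives a colour, which spoils at most m / c edges, so that
-- this can be repeated for each colour.

open import Algebra.Bundles using (CommutativeMonoid)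
open import Algebra.Properties.CommutativeSemigroup using (interchange)
open import Data.Bool.Base using (Bool; true; false; _∧_; _∨_; not; T; if_then_else_)
open import Data.Bool.Properties using (∧-zeroʳ; ∧-identityʳ; ∧-comm; ∧-assoc)
open import Data.Fin.Base as Fin using (Fin; toℕ; fromℕ<; combine; remQuot)
import Data.Fin.Properties as Fin
import Data.Integer.Base as ℤ
import Data.Integer.Properties as ℤ
open import Data.List.Base using (List; []; _∷_; _++_; allFin; cartesianProduct; filter; length; map; tabulate)
open import Data.Nat.Base
open import Data.Nat.DivMod
  using (_/_; _%_; m%n<n; m≡m%n+[m/n]*n; m/n*n≤m; /-monoˡ-≤; m<n*o⇒m/o<n; m≥n⇒m/n>0)
open import Data.Nat.Properties
open import Data.Nat.Tactic.RingSolver using (solve-∀)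
open import Data.Product.Base using (∃; ∃-syntax; _×_; _,_; proj₁; proj₂; uncurry)
open import Data.Rational.Base as ℚ using (toℚᵘ)
import Data.Rational.Properties as ℚ
open import Data.Rational.Unnormalised.Base as ℚᵘ using (mkℚᵘ)
import Data.Rational.Unnormalised.Properties as ℚᵘ
open import Data.Sum.Base using (_⊎_; inj₁; inj₂)
open import Function.Base using (_∘_; const; id)
open import Relation.Binary.Definitions using (tri<; tri≈; tri>)
open import Relation.Binary.PropositionalEquality
open import Relation.Nullary using (¬_; Dec; yes; no; contradiction; does)
open import Relation.Unary using (Pred; Decidable)
open import Defs

-- Finite sums

χ : Bool → ℕ
χ false = 0
χ true  = 1

∑ : ℕ → (ℕ → ℕ) → ℕ
∑ zero    f = 0
∑ (suc n) f = ∑ n f + f n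

syntax ∑ n (λ i → x) = ∑[ i < n ] x

∑-mono : ∀ n {f g : ℕ → ℕ} → (∀ {i} → i < n → f i ≤ g i) → ∑ n f ≤ ∑ n g
∑-mono zero    f≤g = z≤n
∑-mono (suc n) f≤g = +-mono-≤ (∑-mono n (f≤g ∘ m<n⇒m<1+n)) (f≤g (n<1+n n))

∑-cong : ∀ n {f g : ℕ → ℕ} → (∀ {i} → i < n → f i ≡ g i) → ∑ n f ≡ ∑ n g
∑-cong zero    f≡g = refl
∑-cong (suc n) f≡g = cong₂ _+_ (∑-cong n (f≡g ∘ m<n⇒m<1+n)) (f≡g (n<1+n n))

∑-zero : ∀ n → ∑[ _ < n ] 0 ≡ 0
∑-zero zero    = refl
∑-zero (suc n) = trans (+-identityʳ _) (∑-zero n)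

∑-distrib-+ : ∀ n (f g : ℕ → ℕ) → ∑[ i < n ] (f i + g i) ≡ ∑ n f + ∑ n g
∑-distrib-+ zero    f g = refl
∑-distrib-+ (suc n) f g = begin
  ∑[ i < n ] (f i + g i) + (f n + g n)  ≡⟨ cong (_+ (f n + g n)) (∑-distrib-+ n f g) ⟩
  ∑ n f + ∑ n g + (f n + g n)           ≡⟨ +-interchange (∑ n f) (∑ n g) (f n) (g n) ⟩
  ∑ n f + f n + (∑ n g + g n)           ∎
  where
  open ≡-Reasoning
  +-interchange : ∀ a b c d → a + b + (c + d) ≡ a + c + (b + d)
  +-interchange = solve-∀

∑-distribˡ-* : ∀ n k (f : ℕ → ℕ) → ∑[ i < n ] (k * f i) ≡ k * ∑ n f
∑-distribˡ-* zero    k f = sym (*-zeroʳ k)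
∑-distribˡ-* (suc n) k f =
  trans (cong (_+ k * f n) (∑-distribˡ-* n k f)) (sym (*-distribˡ-+ k (∑ n f) (f n)))

∑-const : ∀ n k → ∑[ _ < n ] k ≡ n * k
∑-const zero    k = refl
∑-const (suc n) k = trans (cong (_+ k) (∑-const n k)) (+-comm (n * k) k)

∑-comm : ∀ m n (f : ℕ → ℕ → ℕ) →
         ∑[ i < m ] ∑[ j < n ] f i j ≡ ∑[ j < n ] ∑[ i < m ] f i j
∑-comm zero    n f = sym (∑-zero n)
∑-comm (suc m) n f =
  trans (cong (_+ ∑ n (f m)) (∑-comm m n f)) (sym (∑-distrib-+ n _ (f m)))

term≤∑ : ∀ n (f : ℕ → ℕ) {i} → i < n → f i ≤ ∑ n f
term≤∑ (suc n) f i<1+n with m≤n⇒m<n∨m≡n (s≤s⁻¹ i<1+n)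
... | inj₁ i<n  = ≤-trans (term≤∑ n f i<n) (m≤m+n _ _)
... | inj₂ refl = m≤n+m _ _

≡ᵇ-refl : ∀ i → (i ≡ᵇ i) ≡ true
≡ᵇ-refl zero    = refl
≡ᵇ-refl (suc i) = ≡ᵇ-refl i

≢⇒≡ᵇ : ∀ {i j} → i ≢ j → (i ≡ᵇ j) ≡ false
≢⇒≡ᵇ {i} {j} i≢j with i ≡ᵇ j in eq
... | false = refl
... | true  = contradiction (≡ᵇ⇒≡ i j (subst T (sym eq) _)) i≢j

∑-δ : ∀ n (f : ℕ → ℕ) {i} → i < n → ∑[ j < n ] (χ (i ≡ᵇ j) * f j) ≡ f i
∑-δ (suc n) f {i} i<1+n with m≤n⇒m<n∨m≡n (s≤s⁻¹ i<1+n)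
... | inj₁ i<n  =
  trans (cong₂ _+_ (∑-δ n f i<n) (cong (λ b → χ b * f n) (≢⇒≡ᵇ (<⇒≢ i<n)))) (+-identityʳ _)
... | inj₂ refl =
  trans (cong₂ _+_
          (trans (∑-cong n λ {j} j<n → cong (λ b → χ b * f j) (≢⇒≡ᵇ (≢-sym (<⇒≢ j<n)))) (∑-zero n))
          (cong (λ b → χ b * f n) (≡ᵇ-refl n)))
        (+-identityʳ (f n))

∑>0⇒term>0 : ∀ n (f : ℕ → ℕ) → 0 < ∑ n f → ∃[ i ] i < n × 0 < f i
∑>0⇒term>0 (suc n) f 0<∑ with f n in eq
... | suc _ = n , n<1+n n , subst (0 <_) (sym eq) z<s
... | zero  with i , i<n , p ← ∑>0⇒term>0 n f (subst (0 <_) (+-identityʳ _) 0<∑) =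
  i , m<n⇒m<1+n i<n , p

-- Pigeonhole: `n` positive terms would add up to at least `n`.
∑<n⇒term≡0 : ∀ n (f : ℕ → ℕ) → ∑ n f < n → ∃[ i ] i < n × f i ≡ 0
∑<n⇒term≡0 (suc n) f ∑<n with f n in eq
... | zero  = n , n<1+n n , eq
... | suc x with i , i<n , p ← ∑<n⇒term≡0 n f
                   (≤-trans (s≤s (m≤m+n _ x)) (subst (_≤ n) (+-suc _ x) (s≤s⁻¹ ∑<n))) =
  i , m<n⇒m<1+n i<n , p

-- Averaging: a largest term will do.
∑≤n*term : ∀ n (f : ℕ → ℕ) → ∃[ i ] i < suc n × ∑ (suc n) f ≤ suc n * f i
∑≤n*term zero    f = 0 , z<s , ≤-reflexive (sym (+-identityʳ (f 0)))
∑≤n*term (suc n) f with ∑≤n*term n f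
... | i , i<n , p with ≤-total (f i) (f (suc n))
...   | inj₁ q = suc n , n<1+n _
    , ≤-trans (+-monoˡ-≤ _ (≤-trans p (*-monoʳ-≤ (suc n) q))) (≤-reflexive (+-comm _ (f (suc n))))
...   | inj₂ q = i , m<n⇒m<1+n i<n
    , ≤-trans (+-mono-≤ p q) (≤-reflexive (+-comm _ (f i)))

≤⇒≤ᵇ≡true : ∀ {m n} → m ≤ n → (m ≤ᵇ n) ≡ true
≤⇒≤ᵇ≡true {m} {n} m≤n with m ≤ᵇ n | ≤⇒≤ᵇ m≤n
... | true | _ = refl

>⇒≤ᵇ≡false : ∀ {m n} → m > n → (m ≤ᵇ n) ≡ false
>⇒≤ᵇ≡false {m} {n} m>n with m ≤ᵇ n in eq
... | false = refl
... | true  = contradiction (≤ᵇ⇒≤ m n (subst T (sym eq) _)) (<⇒≱ m>n)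

-- Windows and the colourings described by guesses

window : ℕ → ℕ → ℕ → Bool
window a b u = (a ≤ᵇ u) ∧ not (b ≤ᵇ u)

-- The guesses g list four window ends per colour, the highest colour first;
-- colours are numbered from 0, so that j + 1 of them are in use.

painted : (ℕ → ℕ) → ℕ → Bool
painted g u = window (g 0) (g 1) u ∨ window (g 2) (g 3) u

colour : ℕ → (ℕ → ℕ) → ℕ → ℕ
colour zero    g u = 0
colour (suc j) g u = if painted g u then suc j else colour j (λ r → g (4 + r)) u

colour≤ : ∀ j g u → colour j g u ≤ j
colour≤ zero    g u = z≤n
colour≤ (suc j) g u with painted g u
... | true  = ≤-refl
... | false = m≤n⇒m≤1+n (colour≤ j _ u)

colour-cong : ∀ j {g h} → (∀ {r} → r < j * 4 → g r ≡ h r) → ∀ u → colour j g u ≡ colour j h u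
colour-cong zero    g≗h u = refl
colour-cong (suc j) g≗h u
  rewrite g≗h {0} (s≤s z≤n) | g≗h {1} (s≤s (s≤s z≤n)) | g≗h {2} (s≤s (s≤s (s≤s z≤n)))
        | g≗h {3} (s≤s (s≤s (s≤s (s≤s z≤n)))) | colour-cong j (λ r< → g≗h (+-monoʳ-< 4 r<)) u = refl

module _ (n : ℕ) where

  Bounded : (ℕ → ℕ) → Set
  Bounded g = ∀ r → g r ≤ n

  -- Only vertices below `n` matter, and the ends stay at most `n` because the search tries no
  -- larger guess.
  IsWindow : (ℕ → Bool) → Set
  IsWindow X = ∃[ a ] ∃[ b ] a ≤ n × b ≤ n × (∀ {u} → u < n → window a b u ≡ X u)

  -- The four new window ends come first and push the old guesses up by four places, so the new
  -- colour overwrites the old ones. All three constructions of colourings below add a colour in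
  -- this way.
  extend : ∀ j {X Y g} → IsWindow X → IsWindow Y → Bounded g →
           ∃[ h ] Bounded h ×
             (∀ {u} → u < n → colour (suc j) h u ≡ (if X u ∨ Y u then suc j else colour j g u))
  extend j {g = g} (a , b , a≤n , b≤n , ab≗X) (a′ , b′ , a′≤n , b′≤n , ab≗Y) g≤n = h , h≤n , eq
    where
    h : ℕ → ℕ
    h 0 = a
    h 1 = b
    h 2 = a′
    h 3 = b′
    h (suc (suc (suc (suc r)))) = g r
    h≤n : Bounded h
    h≤n 0 = a≤n
    h≤n 1 = b≤n
    h≤n 2 = a′≤n
    h≤n 3 = b′≤n
    h≤n (suc (suc (suc (suc r)))) = g≤n r
    eq : ∀ {u} → u < n → colour (suc j) h u ≡ _
    eq u<n rewrite ab≗X u<n | ab≗Y u<n = refl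

window-point : ∀ p x → window p (suc p) x ≡ (p ≡ᵇ x)
window-point zero    zero    = refl
window-point zero    (suc x) = refl
window-point (suc p) zero    = refl
window-point (suc zero) (suc x) = window-point zero x
window-point (suc (suc p)) (suc x) = window-point (suc p) x

singleton-isWindow : ∀ {n x} → x < n → IsWindow n (x ≡ᵇ_)
singleton-isWindow {x = x} x<n = x , suc x , <⇒≤ x<n , x<n , λ {u} _ → window-point x u

module _ (β : ℕ → ℕ) (β-mono : ∀ {u v} → u ≤ v → β u ≤ β v) where

  -- As `β` is monotone, the `u` with `p ≤ β u` form a final segment; `a` is its first element, or
  -- `n` if it is empty.
  threshold : ∀ n p → ∃[ a ] a ≤ n × (∀ {u} → u < n → (a ≤ᵇ u) ≡ (p ≤ᵇ β u))
  threshold zero    p = 0 , z≤n , λ ()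
  threshold (suc n) p with p ≤? β n | threshold n p
  ... | yes p≤ | a , a≤n , h = a , m≤n⇒m≤1+n a≤n , λ u<1+n → case (m≤n⇒m<n∨m≡n (s≤s⁻¹ u<1+n))
    where
    case : ∀ {u} → u < n ⊎ u ≡ n → (a ≤ᵇ u) ≡ (p ≤ᵇ β u)
    case (inj₁ u<n)  = h u<n
    case (inj₂ refl) = trans (≤⇒≤ᵇ≡true a≤n) (sym (≤⇒≤ᵇ≡true p≤))
  ... | no p≰ | _ = suc n , ≤-refl , λ u<1+n →
    trans (>⇒≤ᵇ≡false u<1+n) (sym (>⇒≤ᵇ≡false (≤-<-trans (β-mono (s≤s⁻¹ u<1+n)) (≰⇒> p≰))))

  -- A level of a monotone function lies between two consecutive thresholds.
  level-isWindow : ∀ n p → IsWindow n (λ u → p ≡ᵇ β u)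
  level-isWindow n p
    with a , a≤n , ha ← threshold n p | b , b≤n , hb ← threshold n (suc p) =
    a , b , a≤n , b≤n , λ {u} u<n →
      trans (cong₂ (λ x y → x ∧ not y) (ha u<n) (hb u<n)) (window-point p (β u))

-- Sums of indicators

≡ᵇ-sym : ∀ i j → (i ≡ᵇ j) ≡ (j ≡ᵇ i)
≡ᵇ-sym zero    zero    = refl
≡ᵇ-sym zero    (suc j) = refl
≡ᵇ-sym (suc i) zero    = refl
≡ᵇ-sym (suc i) (suc j) = ≡ᵇ-sym i j

≡ᵇ-true : ∀ {i j} → (i ≡ᵇ j) ≡ true → i ≡ j
≡ᵇ-true {i} {j} eq = ≡ᵇ⇒≡ i j (subst T (sym eq) _)

∑-indicator : ∀ n {i} → i < n → ∑[ j < n ] χ (i ≡ᵇ j) ≡ 1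
∑-indicator n i<n =
  trans (∑-cong n λ _ → sym (*-identityʳ _)) (∑-δ n (const 1) i<n)

∑-indicator≤1 : ∀ n i → ∑[ j < n ] χ (i ≡ᵇ j) ≤ 1
∑-indicator≤1 n i with i <? n
... | yes i<n = ≤-reflexive (∑-indicator n i<n)
... | no  i≮n = ≤-trans (≤-reflexive (trans (∑-cong n λ {j} j<n → cong χ
    (≢⇒≡ᵇ {i} {j} λ { refl → i≮n j<n })) (∑-zero n))) z≤n

∑-pairIndicator : ∀ n {i j} → i < n → j < n →
                  ∑[ p < n ] ∑[ q < n ] (χ (i ≡ᵇ p) * χ (j ≡ᵇ q)) ≡ 1
∑-pairIndicator n {i} {j} i<n j<n = begin
  ∑[ p < n ] ∑[ q < n ] (χ (i ≡ᵇ p) * χ (j ≡ᵇ q))  ≡⟨ ∑-cong n (λ {p} _ → ∑-distribˡ-* n (χ (i ≡ᵇ p)) _) ⟩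
  ∑[ p < n ] (χ (i ≡ᵇ p) * ∑[ q < n ] χ (j ≡ᵇ q))  ≡⟨ ∑-δ n (const _) i<n ⟩
  ∑[ q < n ] χ (j ≡ᵇ q)                            ≡⟨ ∑-indicator n j<n ⟩
  1                                                ∎
  where open ≡-Reasoning

-- Cutting the vertices into blocks by weight

m<1+[m/n]*n : ∀ m n .{{_ : NonZero n}} → m < suc (m / n) * n
m<1+[m/n]*n m n = begin-strict
  m                    ≡⟨ m≡m%n+[m/n]*n m n ⟩
  m % n + (m / n) * n  <⟨ +-monoˡ-< _ (m%n<n m n) ⟩
  suc (m / n) * n      ∎
  where open ≤-Reasoning

module Blocks (w : ℕ → ℕ) (W : ℕ) .{{_ : NonZero W}} where

  prefix : ℕ → ℕ
  prefix u = ∑ u w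

  prefix-mono : ∀ {u v} → u ≤ v → prefix u ≤ prefix v
  prefix-mono {u} {zero}  z≤n = z≤n
  prefix-mono {u} {suc v} u≤1+v with m≤n⇒m<n∨m≡n u≤1+v
  ... | inj₁ u≤v  = ≤-trans (prefix-mono (s≤s⁻¹ u≤v)) (m≤m+n _ _)
  ... | inj₂ refl = ≤-refl

  -- A vertex is sorted by the weight in front of it, so that blocks are consecutive and a new one
  -- starts once a multiple of `W` has been reached.
  block : ℕ → ℕ
  block u = prefix u / W

  block-mono : ∀ {u v} → u ≤ v → block u ≤ block v
  block-mono u≤v = /-monoˡ-≤ W (prefix-mono u≤v)

  weight : ℕ → ℕ → ℕ
  weight p n = ∑[ u < n ] (χ (p ≡ᵇ block u) * w u)

  -- Block `p` collects nothing before the prefix sum reaches `p * W`.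
  weight-offset : ∀ p n → weight p n + p * W ≤ prefix n ⊔ (p * W)
  weight-offset p zero    = ≤-refl
  weight-offset p (suc n) with p ≡ᵇ block n in eq
  ... | false = begin
    weight p n + 0 + p * W          ≡⟨ cong (_+ p * W) (+-identityʳ (weight p n)) ⟩
    weight p n + p * W              ≤⟨ weight-offset p n ⟩
    prefix n ⊔ (p * W)              ≤⟨ ⊔-monoˡ-≤ (p * W) (m≤m+n (prefix n) (w n)) ⟩
    (prefix n + w n) ⊔ (p * W)      ∎
    where open ≤-Reasoning
  ... | true  = begin
    weight p n + 1 * w n + p * W    ≡⟨ lemma (weight p n) (w n) (p * W) ⟩
    weight p n + p * W + w n        ≤⟨ +-monoˡ-≤ (w n) (weight-offset p n) ⟩
    prefix n ⊔ (p * W) + w n        ≡⟨ cong (_+ w n) (m≥n⇒m⊔n≡m (subst (λ x → x * W ≤ prefix n)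
                                         (sym (≡ᵇ-true {p} eq)) (m/n*n≤m (prefix n) W))) ⟩
    prefix n + w n                  ≤⟨ m≤m⊔n (prefix n + w n) (p * W) ⟩
    (prefix n + w n) ⊔ (p * W)      ∎
    where
    open ≤-Reasoning
    lemma : ∀ a b c → a + 1 * b + c ≡ a + c + b
    lemma = solve-∀

  -- The last vertex of a block joins it while the block still weighs less than `W`, so the
  -- overshoot is at most the weight of one vertex.
  weight<W+D : ∀ {D} p n → (∀ {u} → u < n → w u ≤ D) → weight p n < W + D
  weight<W+D {D} p zero    w≤D = ≤-trans (>-nonZero⁻¹ W) (m≤m+n W D)
  weight<W+D {D} p (suc n) w≤D with p ≡ᵇ block n in eq
  ... | false = subst (_< W + D) (sym (+-identityʳ _)) (weight<W+D p n (w≤D ∘ m<n⇒m<1+n))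
  ... | true with refl ← ≡ᵇ-true {p} eq =
    subst (λ x → weight p n + x < W + D) (sym (*-identityˡ (w n)))
          (+-mono-<-≤ weight<W (w≤D (n<1+n n)))
    where
    open ≤-Reasoning
    weight<W : weight p n < W
    weight<W = +-cancelʳ-< (p * W) _ _ (begin-strict
      weight p n + p * W  ≤⟨ weight-offset p n ⟩
      prefix n ⊔ (p * W)  ≡⟨ m≥n⇒m⊔n≡m (m/n*n≤m (prefix n) W) ⟩
      prefix n            <⟨ m<1+[m/n]*n (prefix n) W ⟩
      W + p * W           ∎)

  -- Steps of at most 1 cannot jump over a multiple of `W`: block `p` starts at exactly `p * W` and,
  -- if the total permits, fills up to `suc p * W`.
  weight-lower : ∀ p n → (∀ u → w u ≤ 1) → prefix n ⊓ (suc p * W) ≤ weight p n + p * W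
  weight-lower p zero    w≤1 = z≤n
  weight-lower p (suc n) w≤1 with p ≡ᵇ block n in eq
  ... | true with refl ← ≡ᵇ-true {p} eq = begin
    (prefix n + w n) ⊓ (suc p * W)         ≤⟨ m⊓n≤m _ _ ⟩
    prefix n + w n                         ≡⟨ cong (_+ w n) (m≤n⇒m⊓n≡m (<⇒≤ (m<1+[m/n]*n (prefix n) W))) ⟨
    prefix n ⊓ (suc p * W) + w n           ≤⟨ +-monoˡ-≤ (w n) (weight-lower p n w≤1) ⟩
    weight p n + p * W + w n               ≡⟨ lemma (weight p n) (w n) (p * W) ⟩
    weight p n + 1 * w n + p * W           ∎
    where
    open ≤-Reasoning
    lemma : ∀ a b c → a + c + b ≡ a + 1 * b + c
    lemma = solve-∀
  ... | false with <-cmp p (block n)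
  ...   | tri≈ _ refl _ = contradiction (trans (sym (≡ᵇ-refl p)) eq) λ ()
  ...   | tri> _ _ b<p = begin
    (prefix n + w n) ⊓ (suc p * W)         ≤⟨ m⊓n≤m _ _ ⟩
    prefix n + w n                         ≤⟨ +-monoʳ-≤ (prefix n) (w≤1 n) ⟩
    prefix n + 1                           ≡⟨ +-comm _ 1 ⟩
    suc (prefix n)                         ≤⟨ m<1+[m/n]*n (prefix n) W ⟩
    suc (block n) * W                      ≤⟨ *-monoˡ-≤ W b<p ⟩
    p * W                                  ≤⟨ m≤n+m _ _ ⟩
    weight p n + 0 + p * W                 ∎
    where open ≤-Reasoning
  ...   | tri< p<b _ _ = begin
    (prefix n + w n) ⊓ (suc p * W)         ≤⟨ m⊓n≤n (prefix n + w n) _ ⟩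
    suc p * W                              ≡⟨ m≥n⇒m⊓n≡n (≤-trans (*-monoˡ-≤ W p<b) (m/n*n≤m (prefix n) W)) ⟨
    prefix n ⊓ (suc p * W)                 ≤⟨ weight-lower p n w≤1 ⟩
    weight p n + p * W                     ≡⟨ cong (_+ p * W) (+-identityʳ (weight p n)) ⟨
    weight p n + 0 + p * W                 ∎
    where open ≤-Reasoning

-- Vertex sets, arcs and volumes

infixl 7 _∩_ _∖_
infixl 6 _∪_

VertexSet : Set
VertexSet = ℕ → Bool

full : VertexSet
full _ = true

_∩_ _∖_ _∪_ : VertexSet → VertexSet → VertexSet
(X ∩ Y) u = X u ∧ Y u
(X ∖ Y) u = X u ∧ not (Y u)
(X ∪ Y) u = X u ∨ Y u

level : (ℕ → ℕ) → ℕ → VertexSet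
level f i u = i ≡ᵇ f u

-- Adjacency relations on ℕ, of which only the vertices below n matter.

record IsAdjacency (A : ℕ → ℕ → Bool) : Set where
  field
    symmetric   : ∀ u v → A u v ≡ A v u
    irreflexive : ∀ v → A v v ≡ false

module Arcs (n : ℕ) where

  -- Each edge inside S counts twice.
  arcs : (ℕ → ℕ → Bool) → VertexSet → ℕ
  arcs A S = ∑[ u < n ] ∑[ v < n ] χ (A u v ∧ S u ∧ S v)

  degree : (ℕ → ℕ → Bool) → ℕ → ℕ
  degree A u = ∑[ v < n ] χ (A u v)

  volume : (ℕ → ℕ → Bool) → VertexSet → ℕ
  volume A S = ∑[ u < n ] (χ (S u) * degree A u)

  ∑²-mono : ∀ {f g : ℕ → ℕ → ℕ} → (∀ {u v} → u < n → v < n → f u v ≤ g u v) →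
            ∑[ u < n ] ∑[ v < n ] f u v ≤ ∑[ u < n ] ∑[ v < n ] g u v
  ∑²-mono f≤g = ∑-mono n λ u<n → ∑-mono n λ v<n → f≤g u<n v<n

  ∑²-cong : ∀ {f g : ℕ → ℕ → ℕ} → (∀ {u v} → u < n → v < n → f u v ≡ g u v) →
            ∑[ u < n ] ∑[ v < n ] f u v ≡ ∑[ u < n ] ∑[ v < n ] g u v
  ∑²-cong f≡g = ∑-cong n λ u<n → ∑-cong n λ v<n → f≡g u<n v<n

  ∑²-distrib-+ : ∀ (f g : ℕ → ℕ → ℕ) → ∑[ u < n ] ∑[ v < n ] (f u v + g u v) ≡
                 ∑[ u < n ] ∑[ v < n ] f u v + ∑[ u < n ] ∑[ v < n ] g u v
  ∑²-distrib-+ f g =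
    trans (∑-cong n λ _ → ∑-distrib-+ n _ _) (∑-distrib-+ n _ _)

  arcs-full : ∀ A → arcs A full ≡ ∑[ u < n ] degree A u
  arcs-full A = ∑²-cong λ {u} {v} _ _ → cong χ (∧-identityʳ (A u v))

  arcs-mono : ∀ A A′ S S′ →
              (∀ {u v} → u < n → v < n → A u v ≡ true → S u ≡ true → S v ≡ true →
               A′ u v ≡ true × S′ u ≡ true × S′ v ≡ true) →
              arcs A S ≤ arcs A′ S′
  arcs-mono A A′ S S′ h = ∑²-mono λ {u} {v} u<n v<n → pointwise u v (h u<n v<n)
    where
    pointwise : ∀ u v → (A u v ≡ true → S u ≡ true → S v ≡ true →
                         A′ u v ≡ true × S′ u ≡ true × S′ v ≡ true) →
                χ (A u v ∧ S u ∧ S v) ≤ χ (A′ u v ∧ S′ u ∧ S′ v)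
    pointwise u v h with A u v | S u | S v
    ... | false | _     | _     = z≤n
    ... | true  | false | _     = z≤n
    ... | true  | true  | false = z≤n
    ... | true  | true  | true with A′ u v | S′ u | S′ v | h refl refl refl
    ...   | true | true | true | _ = ≤-refl

  0<arcs⇒arc : ∀ A S → 0 < arcs A S →
               ∃[ u ] ∃[ v ] u < n × v < n × A u v ≡ true × S u ≡ true × S v ≡ true
  0<arcs⇒arc A S 0<arcs
    with u , u<n , p ← ∑>0⇒term>0 n _ 0<arcs
    with v , v<n , q ← ∑>0⇒term>0 n _ p =
    u , v , u<n , v<n , split (A u v) (S u) (S v) q
    where
    split : ∀ a s t → 0 < χ (a ∧ s ∧ t) → a ≡ true × s ≡ true × t ≡ true
    split true true true _ = refl , refl , refl

  -- A pair of vertices lies in a common level for at most one `i`.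
  arcs-disjoint : ∀ A (f : ℕ → ℕ) c → ∑[ i < c ] arcs A (level f i) ≤ arcs A full
  arcs-disjoint A f c = begin
    ∑[ i < c ] ∑[ u < n ] ∑[ v < n ] χ (A u v ∧ level f i u ∧ level f i v)
      ≡⟨ ∑-comm c n _ ⟩
    ∑[ u < n ] ∑[ i < c ] ∑[ v < n ] χ (A u v ∧ level f i u ∧ level f i v)
      ≡⟨ ∑-cong n (λ _ → ∑-comm c n _) ⟩
    ∑[ u < n ] ∑[ v < n ] ∑[ i < c ] χ (A u v ∧ level f i u ∧ level f i v)
      ≤⟨ ∑²-mono (λ {u} {v} _ _ → pointwise (A u v) u v) ⟩
    ∑[ u < n ] ∑[ v < n ] χ (A u v ∧ true)
      ∎
    where
    open ≤-Reasoning
    ∧≤ : ∀ a b → χ (a ∧ b) ≤ χ a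
    ∧≤ false b     = z≤n
    ∧≤ true  false = z≤n
    ∧≤ true  true  = ≤-refl
    ≡ᵇ-swap : ∀ i u → χ (level f i u) ≡ χ (f u ≡ᵇ i)
    ≡ᵇ-swap i u = cong χ (≡ᵇ-sym i (f u))
    pointwise : ∀ a u v → ∑[ i < c ] χ (a ∧ level f i u ∧ level f i v) ≤ χ (a ∧ true)
    pointwise false u v = ≤-reflexive (∑-zero c)
    pointwise true  u v = ≤-trans
      (∑-mono c λ {i} _ → ≤-trans (∧≤ (level f i u) _) (≤-reflexive (≡ᵇ-swap i u)))
      (∑-indicator≤1 c (f u))

  volume-∪ : ∀ A X Y → volume A (X ∪ Y) ≤ volume A X + volume A Y
  volume-∪ A X Y = begin
    volume A (X ∪ Y)
      ≤⟨ ∑-mono n (λ {u} _ → *-monoˡ-≤ (degree A u) (χ-∨ (X u) (Y u))) ⟩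
    ∑[ u < n ] ((χ (X u) + χ (Y u)) * degree A u)
      ≡⟨ ∑-cong n (λ {u} _ → *-distribʳ-+ (degree A u) (χ (X u)) (χ (Y u))) ⟩
    ∑[ u < n ] (χ (X u) * degree A u + χ (Y u) * degree A u)
      ≡⟨ ∑-distrib-+ n _ _ ⟩
    volume A X + volume A Y
      ∎
    where
    open ≤-Reasoning
    χ-∨ : ∀ a b → χ (a ∨ b) ≤ χ a + χ b
    χ-∨ false b = ≤-refl
    χ-∨ true  b = m≤m+n 1 (χ b)

  ∑-volume≤arcs : ∀ A (f : ℕ → ℕ) m → ∑[ q < m ] volume A (level f q) ≤ arcs A full
  ∑-volume≤arcs A f m = begin
    ∑[ q < m ] ∑[ u < n ] (χ (q ≡ᵇ f u) * degree A u)  ≡⟨ ∑-comm m n _ ⟩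
    ∑[ u < n ] ∑[ q < m ] (χ (q ≡ᵇ f u) * degree A u)  ≤⟨ ∑-mono n (λ {u} _ → pointwise u) ⟩
    ∑[ u < n ] degree A u                              ≡⟨ arcs-full A ⟨
    arcs A full                                        ∎
    where
    open ≤-Reasoning
    pointwise : ∀ u → ∑[ q < m ] (χ (q ≡ᵇ f u) * degree A u) ≤ degree A u
    pointwise u = begin
      ∑[ q < m ] (χ (q ≡ᵇ f u) * degree A u)
        ≡⟨ ∑-cong m (λ {q} _ → trans (*-comm (χ (q ≡ᵇ f u)) _) (cong (λ b → degree A u * χ b) (≡ᵇ-sym q (f u)))) ⟩
      ∑[ q < m ] (degree A u * χ (f u ≡ᵇ q))
        ≡⟨ ∑-distribˡ-* m (degree A u) _ ⟩
      degree A u * ∑[ q < m ] χ (f u ≡ᵇ q)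
        ≤⟨ *-monoʳ-≤ (degree A u) (∑-indicator≤1 m (f u)) ⟩
      degree A u * 1
        ≡⟨ *-identityʳ _ ⟩
      degree A u
        ∎

  -- An arc that is lost has its tail or its head in `S`; the rows and the columns of `S` each
  -- contribute its volume.
  arcs-∖ : ∀ {A} → IsAdjacency A → ∀ U S → arcs A U ≤ arcs A (U ∖ S) + 2 * volume A S
  arcs-∖ {A} adjacency U S = begin
    ∑[ u < n ] ∑[ v < n ] χ (A u v ∧ U u ∧ U v)
      ≤⟨ ∑²-mono (λ {u} {v} _ _ → pointwise (A u v) (U u) (U v) (S u) (S v)) ⟩
    ∑[ u < n ] ∑[ v < n ] (χ (A u v ∧ (U ∖ S) u ∧ (U ∖ S) v) + (χ (S u) * χ (A u v) + χ (S v) * χ (A u v)))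
      ≡⟨ ∑²-distrib-+ _ _ ⟩
    arcs A (U ∖ S) + ∑[ u < n ] ∑[ v < n ] (χ (S u) * χ (A u v) + χ (S v) * χ (A u v))
      ≡⟨ cong (arcs A (U ∖ S) +_) (∑²-distrib-+ _ _) ⟩
    arcs A (U ∖ S) + (∑[ u < n ] ∑[ v < n ] (χ (S u) * χ (A u v)) + ∑[ u < n ] ∑[ v < n ] (χ (S v) * χ (A u v)))
      ≡⟨ cong (arcs A (U ∖ S) +_) (cong₂ _+_ rows (trans (∑-comm n n _) (trans columns (sym (+-identityʳ _))))) ⟩
    arcs A (U ∖ S) + 2 * volume A S
      ∎
    where
    open ≤-Reasoning
    open IsAdjacency adjacency
    rows : ∑[ u < n ] ∑[ v < n ] (χ (S u) * χ (A u v)) ≡ volume A S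
    rows = ∑-cong n λ {u} _ → ∑-distribˡ-* n (χ (S u)) _
    columns : ∑[ v < n ] ∑[ u < n ] (χ (S v) * χ (A u v)) ≡ volume A S
    columns = trans (∑²-cong λ {v} {u} _ _ → cong (λ a → χ (S v) * χ a) (symmetric u v)) rows
    pointwise : ∀ a x y s t →
      χ (a ∧ x ∧ y) ≤ χ (a ∧ (x ∧ not s) ∧ (y ∧ not t)) + (χ s * χ a + χ t * χ a)
    pointwise false x     y     s     t     = z≤n
    pointwise true  false y     s     t     = z≤n
    pointwise true  true  false s     t     = z≤n
    pointwise true  true  true  true  t     = s≤s z≤n
    pointwise true  true  true  false true  = s≤s z≤n
    pointwise true  true  true  false false = s≤s z≤n

  -- The pairs `(x , y)` and `(y , x)` are different arcs, since irreflexivity excludes a loop.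
  edge⇒2≤arcs : ∀ {A} → IsAdjacency A → ∀ S {x y} → x < n → y < n →
                A x y ≡ true → S x ≡ true → S y ≡ true → 2 ≤ arcs A S
  edge⇒2≤arcs {A} adjacency S {x} {y} x<n y<n axy sx sy = begin
    2
      ≡⟨ cong₂ _+_ (∑-pairIndicator n x<n y<n) (∑-pairIndicator n y<n x<n) ⟨
    ∑[ u < n ] ∑[ v < n ] (χ (x ≡ᵇ u) * χ (y ≡ᵇ v)) + ∑[ u < n ] ∑[ v < n ] (χ (y ≡ᵇ u) * χ (x ≡ᵇ v))
      ≡⟨ ∑²-distrib-+ _ _ ⟨
    ∑[ u < n ] ∑[ v < n ] (χ (x ≡ᵇ u) * χ (y ≡ᵇ v) + χ (y ≡ᵇ u) * χ (x ≡ᵇ v))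
      ≤⟨ ∑²-mono (λ {u} {v} _ _ → pointwise u v) ⟩
    arcs A S
      ∎
    where
    open ≤-Reasoning
    open IsAdjacency adjacency
    x≢y : x ≢ y
    x≢y refl = contradiction (trans (sym axy) (irreflexive x)) λ ()
    pointwise : ∀ u v → χ (x ≡ᵇ u) * χ (y ≡ᵇ v) + χ (y ≡ᵇ u) * χ (x ≡ᵇ v) ≤ χ (A u v ∧ S u ∧ S v)
    pointwise u v with x ≡ᵇ u in xu | y ≡ᵇ v in yv | y ≡ᵇ u in yu | x ≡ᵇ v in xv
    ... | true  | _     | true  | _     =
      contradiction (trans (≡ᵇ-true {x} xu) (sym (≡ᵇ-true {y} yu))) x≢y
    ... | true  | true  | false | _
      rewrite sym (≡ᵇ-true {x} xu) | sym (≡ᵇ-true {y} yv) | axy | sx | sy = ≤-refl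
    ... | true  | false | false | _     = z≤n
    ... | false | _     | false | _     = z≤n
    ... | false | _     | true  | false = z≤n
    ... | false | _     | true  | true
      rewrite sym (≡ᵇ-true {y} yu) | sym (≡ᵇ-true {x} xv) | symmetric y x | axy | sx | sy = ≤-refl

  -- Each neighbour of `x` in `R` gives one arc from `x` and one to `x`.
  star⇒arcs : ∀ {A} → IsAdjacency A → ∀ R {x} → x < n →
              2 * ∑[ u < n ] (χ (R u) * χ (A x u)) ≤ arcs A ((x ≡ᵇ_) ∪ R)
  star⇒arcs {A} adjacency R {x} x<n = begin
    2 * ∑ n leaf
      ≡⟨ cong (∑ n leaf +_) (+-identityʳ _) ⟩
    ∑ n leaf + ∑ n leaf
      ≡⟨ cong₂ _+_ row (trans (∑-comm n n _) row) ⟨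
    ∑[ u < n ] ∑[ v < n ] (χ (x ≡ᵇ u) * leaf v) + ∑[ u < n ] ∑[ v < n ] (χ (x ≡ᵇ v) * leaf u)
      ≡⟨ ∑²-distrib-+ _ _ ⟨
    ∑[ u < n ] ∑[ v < n ] (χ (x ≡ᵇ u) * leaf v + χ (x ≡ᵇ v) * leaf u)
      ≤⟨ ∑²-mono (λ {u} {v} _ _ → pointwise u v) ⟩
    arcs A ((x ≡ᵇ_) ∪ R)
      ∎
    where
    open ≤-Reasoning
    open IsAdjacency adjacency
    leaf : ℕ → ℕ
    leaf u = χ (R u) * χ (A x u)
    row : ∑[ u < n ] ∑[ v < n ] (χ (x ≡ᵇ u) * leaf v) ≡ ∑ n leaf
    row = trans (∑-cong n λ {u} _ → ∑-distribˡ-* n (χ (x ≡ᵇ u)) leaf) (∑-δ n (const (∑ n leaf)) x<n)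
    boolean : ∀ a r → 1 * (χ r * χ a) + 0 ≤ χ (a ∧ r)
    boolean false false = z≤n
    boolean false true  = z≤n
    boolean true  false = z≤n
    boolean true  true  = ≤-refl
    boolean′ : ∀ a r → 1 * (χ r * χ a) ≤ χ (a ∧ r ∧ true)
    boolean′ false false = z≤n
    boolean′ false true  = z≤n
    boolean′ true  false = z≤n
    boolean′ true  true  = ≤-refl
    pointwise : ∀ u v → χ (x ≡ᵇ u) * leaf v + χ (x ≡ᵇ v) * leaf u ≤
                χ (A u v ∧ ((x ≡ᵇ u) ∨ R u) ∧ ((x ≡ᵇ v) ∨ R v))
    pointwise u v with x ≡ᵇ u in xu | x ≡ᵇ v in xv
    ... | false | false = z≤n
    ... | true  | false rewrite sym (≡ᵇ-true {x} xu) = boolean (A x v) (R v)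
    ... | false | true
      rewrite sym (≡ᵇ-true {x} xv) | symmetric u x = boolean′ (A x u) (R u)
    ... | true  | true
      rewrite sym (≡ᵇ-true {x} xu) | sym (≡ᵇ-true {x} xv) | irreflexive x | *-zeroʳ (χ (R x)) = z≤n

  -- If removing the block q costs U i more than half of its arcs, then the
  -- block has more than a quarter of the volume, so at most three blocks do.

  lightBlock : ∀ {A} → IsAdjacency A → ∀ (β : ℕ → ℕ) c (U : ℕ → VertexSet) →
               ∃[ q ] q < suc (c * 3) ×
                 (∀ {i} → i < c → arcs A (U i) ≤ 2 * arcs A (U i ∖ level β q))
  lightBlock {A} adjacency β c U with ∑<n⇒term≡0 M (λ q → ∑[ i < c ] bad i q) few-bad
    where
    open ≤-Reasoning
    M : ℕ
    M = suc (c * 3)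
    bad : ℕ → ℕ → ℕ
    bad i q = χ (2 * arcs A (U i ∖ level β q) <ᵇ arcs A (U i))
    module _ (i : ℕ) where
      open IsAdjacency adjacency
      F : ℕ
      F = arcs A (U i)
      -- Restricting the relation to `U i` makes the volumes of all blocks together at most the
      -- number of arcs inside `U i`.
      A↾ : ℕ → ℕ → Bool
      A↾ u v = A u v ∧ U i u ∧ U i v
      A↾-adjacency : IsAdjacency A↾
      A↾-adjacency = record
        { symmetric   = λ u v → cong₂ _∧_ (symmetric u v) (∧-comm (U i u) (U i v))
        ; irreflexive = λ v → cong (_∧ (U i v ∧ U i v)) (irreflexive v) }
      F≡ : F ≡ arcs A↾ full
      F≡ = ∑²-cong λ {u} {v} _ _ → cong χ (sym (∧-identityʳ (A↾ u v)))
      rest : ∀ q → arcs A↾ (full ∖ level β q) ≤ arcs A (U i ∖ level β q)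
      rest q = ∑²-mono λ {u} {v} _ _ →
        boolean (A u v) (U i u) (U i v) (not (level β q u)) (not (level β q v))
        where
        boolean : ∀ a x y s t → χ ((a ∧ x ∧ y) ∧ s ∧ t) ≤ χ (a ∧ (x ∧ s) ∧ (y ∧ t))
        boolean false x     y     s     t = z≤n
        boolean true  false y     s     t = z≤n
        boolean true  true  false s     t = z≤n
        boolean true  true  true  s     t = ≤-refl
      -- With `suc F` instead of `F` the number of bad blocks comes out strictly below 4, also when
      -- `F` is 0.
      bad≤ : ∀ q → bad i q * suc F ≤ 4 * volume A↾ (level β q)
      bad≤ q with 2 * arcs A (U i ∖ level β q) <ᵇ F in eq
      ... | false = z≤n
      ... | true  = +-cancelˡ-≤ F _ _ (begin
        F + 1 * suc F             ≡⟨ lemma₁ F ⟩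
        suc (2 * F)               ≤⟨ s≤s (*-monoʳ-≤ 2 (≤-trans (≤-reflexive F≡)
                                       (≤-trans (arcs-∖ A↾-adjacency full (level β q))
                                                 (+-monoˡ-≤ _ (rest q))))) ⟩
        suc (2 * (f + 2 * vol))   ≡⟨ lemma₂ f vol ⟩
        suc (2 * f) + 4 * vol     ≤⟨ +-monoˡ-≤ (4 * vol) (<ᵇ⇒< (2 * f) F (subst T (sym eq) _)) ⟩
        F + 4 * vol               ∎)
        where
        f vol : ℕ
        f   = arcs A (U i ∖ level β q)
        vol = volume A↾ (level β q)
        lemma₁ : ∀ x → x + 1 * suc x ≡ suc (2 * x)
        lemma₁ = solve-∀
        lemma₂ : ∀ x y → suc (2 * (x + 2 * y)) ≡ suc (2 * x) + 4 * y
        lemma₂ = solve-∀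
      ∑bad≤ : ∑[ q < M ] bad i q * suc F ≤ 4 * F
      ∑bad≤ = begin
        ∑[ q < M ] bad i q * suc F               ≡⟨ *-comm _ (suc F) ⟩
        suc F * ∑[ q < M ] bad i q               ≡⟨ ∑-distribˡ-* M (suc F) _ ⟨
        ∑[ q < M ] (suc F * bad i q)             ≤⟨ ∑-mono M (λ {q} _ →
                                                      ≤-trans (≤-reflexive (*-comm (suc F) (bad i q))) (bad≤ q)) ⟩
        ∑[ q < M ] (4 * volume A↾ (level β q))   ≡⟨ ∑-distribˡ-* M 4 _ ⟩
        4 * ∑[ q < M ] volume A↾ (level β q)     ≤⟨ *-monoʳ-≤ 4 (∑-volume≤arcs A↾ β M) ⟩
        4 * arcs A↾ full                         ≡⟨ cong (4 *_) F≡ ⟨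
        4 * F                                    ∎
      ∑bad≤3 : ∑[ q < M ] bad i q ≤ 3
      ∑bad≤3 = s≤s⁻¹ (*-cancelʳ-< (suc F) _ 4 (≤-<-trans ∑bad≤ (*-monoʳ-< 4 (n<1+n F))))
    few-bad : ∑[ q < M ] ∑[ i < c ] bad i q < M
    few-bad = s≤s (begin
      ∑[ q < M ] ∑[ i < c ] bad i q  ≡⟨ ∑-comm M c (λ q i → bad i q) ⟩
      ∑[ i < c ] ∑[ q < M ] bad i q  ≤⟨ ∑-mono c (λ {i} _ → ∑bad≤3 i) ⟩
      ∑[ i < c ] 3                   ≡⟨ ∑-const c 3 ⟩
      c * 3                          ∎)
  ... | q , q<M , none = q , q<M , λ i<c → good (n≤0⇒n≡0 (≤-trans (term≤∑ c _ i<c) (≤-reflexive none)))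
    where
    good : ∀ {x y} → χ (x <ᵇ y) ≡ 0 → y ≤ x
    good {x} {y} p = ≮⇒≥ λ x<y → contradiction (trans (sym p) (cong χ (T⇒≡true (<⇒<ᵇ x<y)))) λ ()
      where
      T⇒≡true : ∀ {b} → T b → b ≡ true
      T⇒≡true {true} _ = refl

  -- Averaging over the pairs p , q: every arc inside U lies inside the union
  -- of the levels p and q for at least two ordered pairs.

  heavyPair : ∀ A U (β : ℕ → ℕ) M → 2 ≤ M → (∀ {u} → u < n → β u < M) →
              ∃[ p ] ∃[ q ] 2 * arcs A U ≤ M * (M * arcs A (U ∩ (level β p ∪ level β q)))
  heavyPair A U β (suc zero) (s≤s ()) β<M
  heavyPair A U β M@(suc (suc m)) 2≤M β<M
    with p , _ , hp ← ∑≤n*term (1 + m) (λ p → ∑[ q < 2 + m ] arcs A (U ∩ (level β p ∪ level β q)))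
    with q , _ , hq ← ∑≤n*term (1 + m) (λ q → arcs A (U ∩ (level β p ∪ level β q))) =
    p , q , (begin
      2 * arcs A U                                                            ≤⟨ covered ⟩
      ∑[ p < M ] ∑[ q < M ] arcs A (U ∩ (level β p ∪ level β q))              ≤⟨ hp ⟩
      M * ∑[ q < M ] arcs A (U ∩ (level β p ∪ level β q))                     ≤⟨ *-monoʳ-≤ M hq ⟩
      M * (M * arcs A (U ∩ (level β p ∪ level β q)))                          ∎)
    where
    open ≤-Reasoning
    other : ∀ x → ∃[ z ] z < M × x ≢ z
    other zero    = 1 , s≤s (s≤s z≤n) , λ ()
    other (suc x) = 0 , s≤s z≤n , λ ()
    pairs : ∀ {x y z t} → x < M → y < M → z < M → t < M →
            ∑[ p < M ] ∑[ q < M ] (χ (x ≡ᵇ p) * χ (y ≡ᵇ q) + χ (z ≡ᵇ p) * χ (t ≡ᵇ q)) ≡ 2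
    pairs x<M y<M z<M t<M =
      trans (trans (∑-cong M λ _ → ∑-distrib-+ M _ _) (∑-distrib-+ M _ _))
            (cong₂ _+_ (∑-pairIndicator M x<M y<M) (∑-pairIndicator M z<M t<M))
    boolean : ∀ a b c d → ¬ (a ≡ true × c ≡ true) →
              χ a * χ d + χ c * χ b ≤ χ ((a ∨ b) ∧ (c ∨ d))
    boolean true  b     true  d     h = contradiction (refl , refl) h
    boolean true  b     false false h = z≤n
    boolean true  b     false true  h = s≤s z≤n
    boolean false true  true  d     h = s≤s z≤n
    boolean false false true  d     h = z≤n
    boolean false b     false d     h = z≤n
    boolean₂ : ∀ a b d → ¬ (b ≡ true × d ≡ true) →
               χ a * χ b + χ a * χ d ≤ χ ((a ∨ b) ∧ (a ∨ b))
    boolean₂ true  true  true  h = contradiction (refl , refl) h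
    boolean₂ true  true  false h = s≤s z≤n
    boolean₂ true  false true  h = s≤s z≤n
    boolean₂ true  false false h = z≤n
    boolean₂ false b     d     h = z≤n
    both : ∀ {x y p} → x ≢ y → ¬ ((x ≡ᵇ p) ≡ true × (y ≡ᵇ p) ≡ true)
    both {x} {y} x≢y (e , f) = x≢y (trans (≡ᵇ-true {x} e) (sym (≡ᵇ-true {y} f)))
    count : ∀ x y → x < M → y < M →
            2 ≤ ∑[ p < M ] ∑[ q < M ] χ (((p ≡ᵇ x) ∨ (q ≡ᵇ x)) ∧ ((p ≡ᵇ y) ∨ (q ≡ᵇ y)))
    count x y x<M y<M with x ≟ y
    -- An arc between different levels is covered by the pairs `(x , y)` and `(y , x)`.
    ... | no x≢y = begin
      2  ≡⟨ pairs x<M y<M y<M x<M ⟨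
      ∑[ p < M ] ∑[ q < M ] (χ (x ≡ᵇ p) * χ (y ≡ᵇ q) + χ (y ≡ᵇ p) * χ (x ≡ᵇ q))
         ≤⟨ ∑-mono M (λ {p} _ → ∑-mono M λ {q} _ → ≤-trans
              (boolean (x ≡ᵇ p) (x ≡ᵇ q) (y ≡ᵇ p) (y ≡ᵇ q) (both x≢y))
              (≤-reflexive (cong χ (cong₂ _∧_ (cong₂ _∨_ (≡ᵇ-sym x p) (≡ᵇ-sym x q))
                                              (cong₂ _∨_ (≡ᵇ-sym y p) (≡ᵇ-sym y q)))))) ⟩
      _  ∎
    -- An arc within one level is covered by `(x , x)` and by `(x , z)` for another level `z`, which
    -- exists because `2 ≤ M`.
    ... | yes refl with z , z<M , x≢z ← other x = begin
      2  ≡⟨ pairs x<M x<M x<M z<M ⟨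
      ∑[ p < M ] ∑[ q < M ] (χ (x ≡ᵇ p) * χ (x ≡ᵇ q) + χ (x ≡ᵇ p) * χ (z ≡ᵇ q))
         ≤⟨ ∑-mono M (λ {p} _ → ∑-mono M λ {q} _ → ≤-trans
              (boolean₂ (x ≡ᵇ p) (x ≡ᵇ q) (z ≡ᵇ q) (both x≢z))
              (≤-reflexive (cong χ (cong₂ _∧_ (cong₂ _∨_ (≡ᵇ-sym x p) (≡ᵇ-sym x q))
                                              (cong₂ _∨_ (≡ᵇ-sym x p) (≡ᵇ-sym x q)))))) ⟩
      _  ∎
    ∑∑-comm : ∀ (f : ℕ → ℕ → ℕ → ℕ) →
      ∑[ p < M ] ∑[ q < M ] ∑[ u < n ] f p q u ≡ ∑[ u < n ] ∑[ p < M ] ∑[ q < M ] f p q u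
    ∑∑-comm f = trans (∑-cong M λ _ → ∑-comm M n _) (∑-comm M n _)
    pointwise : ∀ a s t x y → x < M → y < M → χ (a ∧ s ∧ t) + χ (a ∧ s ∧ t) ≤
      ∑[ p < M ] ∑[ q < M ] χ (a ∧ (s ∧ ((p ≡ᵇ x) ∨ (q ≡ᵇ x))) ∧ (t ∧ ((p ≡ᵇ y) ∨ (q ≡ᵇ y))))
    pointwise false s     t     x y x<M y<M = z≤n
    pointwise true  false t     x y x<M y<M = z≤n
    pointwise true  true  false x y x<M y<M = z≤n
    pointwise true  true  true  x y x<M y<M = count x y x<M y<M
    covered : 2 * arcs A U ≤ ∑[ p < M ] ∑[ q < M ] arcs A (U ∩ (level β p ∪ level β q))
    covered = begin
      2 * arcs A U
        ≡⟨ cong (arcs A U +_) (+-identityʳ _) ⟩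
      arcs A U + arcs A U
        ≡⟨ ∑²-distrib-+ _ _ ⟨
      ∑[ u < n ] ∑[ v < n ] (χ (A u v ∧ U u ∧ U v) + χ (A u v ∧ U u ∧ U v))
        ≤⟨ ∑²-mono (λ {u} {v} u<n v<n → pointwise (A u v) (U u) (U v) (β u) (β v) (β<M u<n) (β<M v<n)) ⟩
      ∑[ u < n ] ∑[ v < n ] ∑[ p < M ] ∑[ q < M ]
        χ (A u v ∧ (U ∩ (level β p ∪ level β q)) u ∧ (U ∩ (level β p ∪ level β q)) v)
        ≡⟨ trans (∑∑-comm _) (∑-cong n λ _ → ∑∑-comm _) ⟨
      ∑[ p < M ] ∑[ q < M ] arcs A (U ∩ (level β p ∪ level β q))
        ∎

-- Bounds on the ratio

-- Supplying the difference `k` turns an inequality of polynomials into an identity for the ring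
-- solver.
m+k≡n⇒m≤n : ∀ {m n} k → m + k ≡ n → m ≤ n
m+k≡n⇒m≤n {m} k eq = ≤-trans (m≤m+n m k) (≤-reflexive eq)

-- The approximation ratio for j + 1 colours.

ratio : ℕ → ℕ
ratio zero    = 1
ratio (suc j) = (32 * j + 52) * ratio j

-- `ratio≥lowDegree` and `ratio≥star` use no more of `ratio j` than this linear bound, and so become
-- inequalities between quadratic polynomials in `j`.
j<ratio : ∀ j → j < ratio j
j<ratio zero    = z<s
j<ratio (suc j) = begin
  2 + j                   ≤⟨ m+k≡n⇒m≤n (32 * j * j + 83 * j + 50) (lemma j) ⟩
  (32 * j + 52) * suc j   ≤⟨ *-monoʳ-≤ (32 * j + 52) (j<ratio j) ⟩
  ratio (suc j)           ∎
  where
  open ≤-Reasoning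
  lemma : ∀ j → 2 + j + (32 * j * j + 83 * j + 50) ≡ (32 * j + 52) * suc j
  lemma = solve-∀

-- The factor lost when all degrees are low is `9 * (c * c)` with `c = 2 + j`.
ratio≥lowDegree : ∀ j → 9 * ((2 + j) * (2 + j)) ≤ ratio (suc j)
ratio≥lowDegree j = begin
  9 * ((2 + j) * (2 + j))  ≤⟨ m+k≡n⇒m≤n (23 * j * j + 48 * j + 16) (lemma j) ⟩
  (32 * j + 52) * suc j    ≤⟨ *-monoʳ-≤ (32 * j + 52) (j<ratio j) ⟩
  ratio (suc j)            ∎
  where
  open ≤-Reasoning
  lemma : ∀ j → 9 * ((2 + j) * (2 + j)) + (23 * j * j + 48 * j + 16) ≡ (32 * j + 52) * suc j
  lemma = solve-∀

-- A neighbourhood is cut into `suc (suc j * 3)` blocks, and the factor 12 stems from the degree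
-- threshold.
ratio≥star : ∀ j → 12 * suc (suc j * 3) ≤ ratio (suc j)
ratio≥star j = begin
  12 * suc (suc j * 3)     ≤⟨ m+k≡n⇒m≤n (32 * j * j + 48 * j + 4) (lemma j) ⟩
  (32 * j + 52) * suc j    ≤⟨ *-monoʳ-≤ (32 * j + 52) (j<ratio j) ⟩
  ratio (suc j)            ∎
  where
  open ≤-Reasoning
  lemma : ∀ j → 12 * suc (suc j * 3) + (32 * j * j + 48 * j + 4) ≡ (32 * j + 52) * suc j
  lemma = solve-∀

-- This pays for the half of its arcs that an old colour may lose.
2*ratio≤ratio : ∀ j → ratio j * 2 ≤ ratio (suc j)
2*ratio≤ratio j = begin
  ratio j * 2              ≡⟨ *-comm (ratio j) 2 ⟩
  2 * ratio j              ≤⟨ *-monoˡ-≤ (ratio j) (≤-trans (s≤s (s≤s z≤n)) (m≤n+m 52 (32 * j))) ⟩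
  (32 * j + 52) * ratio j  ∎
  where open ≤-Reasoning

-- Small targets: one edge for each colour

module _ (n : ℕ) where
  open Arcs n

  module _ {A} (adjacency : IsAdjacency A) (ψ : ℕ → ℕ) where
    open IsAdjacency adjacency

    -- Remembering the colour under `ψ` as well keeps the edges of different colours disjoint, so
    -- that painting one never touches another.
    MonochromaticEdge : (ℕ → ℕ) → ℕ → Set
    MonochromaticEdge f i = ∃[ x ] ∃[ y ] x < n × y < n × A x y ≡ true ×
      (ψ x ≡ i × f x ≡ i) × (ψ y ≡ i × f y ≡ i)

    -- Colour `suc t` receives the endvertices of one edge as its two windows; colour 0 keeps all
    -- vertices that are not repainted.
    matching : ∀ t → (∀ {i} → i ≤ t → MonochromaticEdge ψ i) →
               ∃[ g ] Bounded n g × (∀ {i} → i ≤ t → MonochromaticEdge (colour t g) i)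
    matching zero    edge = const 0 , (λ _ → z≤n) , λ where
      z≤n → let x , y , x<n , y<n , axy , (ψx , _) , (ψy , _) = edge z≤n
            in x , y , x<n , y<n , axy , (ψx , refl) , (ψy , refl)
    matching (suc t) edge
      with x , y , x<n , y<n , axy , (ψx , _) , (ψy , _) ← edge ≤-refl
         | g , g≤n , old ← matching t (edge ∘ m≤n⇒m≤1+n)
      with h , h≤n , eq ← extend n t (singleton-isWindow x<n) (singleton-isWindow y<n) g≤n =
      h , h≤n , new
      where
      -- A vertex of an earlier class of `ψ` is neither `x` nor `y`, which lie in class `suc t`.
      kept : ∀ {i u} → i < suc t → u < n → ψ u ≡ i → colour t g u ≡ i → colour (suc t) h u ≡ i
      kept {i} {u} i≤t u<n ψu c rewrite eq u<n
        | ≢⇒≡ᵇ {x} {u} (λ { refl → <⇒≢ i≤t (trans (sym ψu) ψx) })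
        | ≢⇒≡ᵇ {y} {u} (λ { refl → <⇒≢ i≤t (trans (sym ψu) ψy) }) = c
      new : ∀ {i} → i ≤ suc t → MonochromaticEdge (colour (suc t) h) i
      new i≤1+t with m≤n⇒m<n∨m≡n i≤1+t
      ... | inj₁ i<1+t with a , b , a<n , b<n , aab , (ψa , ca) , (ψb , cb) ← old (s≤s⁻¹ i<1+t) =
        a , b , a<n , b<n , aab , (ψa , kept i<1+t a<n ψa ca) , (ψb , kept i<1+t b<n ψb cb)
      ... | inj₂ refl = x , y , x<n , y<n , axy , (ψx , cx) , (ψy , cy)
        where
        cx : colour (suc t) h x ≡ suc t
        cx rewrite eq x<n | ≡ᵇ-refl x = refl
        cy : colour (suc t) h y ≡ suc t
        cy rewrite eq y<n | ≡ᵇ-refl y with x ≡ᵇ y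
        ... | true  = refl
        ... | false = refl

  -- Low degrees: windows of nearly equal volume

  module LowDegree {A} (adjacency : IsAdjacency A) (c κ : ℕ) .{{_ : NonZero c}}
                   (many : c * κ ≤ arcs A full)
                   (low  : ∀ {u} → u < n → 12 * c * degree A u ≤ arcs A full) where
    instance
      6c-nonZero : NonZero (6 * c)
      6c-nonZero = m*n≢0 6 c
      12c-nonZero : NonZero (12 * c)
      12c-nonZero = m*n≢0 12 c

    m M W D w : ℕ
    -- This is twice the number of edges, so `low` keeps every degree within a `6 * c`-th of that
    -- number.
    m = arcs A full
    M = 6 * c
    -- Rounding up gives `m < M * W`, so that there are no more than `M` blocks.
    W = suc (m / M)
    D = m / (12 * c)
    -- A block has volume less than `W + D`, which is `suc w`.
    w = m / M + D

    open Blocks (degree A) W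

    prefix≤m : ∀ {u} → u < n → prefix u ≤ m
    prefix≤m u<n = ≤-trans (prefix-mono (<⇒≤ u<n)) (≤-reflexive (sym (arcs-full A)))

    block<M : ∀ {u} → u < n → block u < M
    block<M {u} u<n = m<n*o⇒m/o<n (begin-strict
      prefix u          ≤⟨ prefix≤m u<n ⟩
      m                 <⟨ m<1+[m/n]*n m M ⟩
      W * M             ≡⟨ *-comm W M ⟩
      M * W             ∎)
      where open ≤-Reasoning

    degree≤D : ∀ {u} → u < n → degree A u ≤ D
    degree≤D {u} u<n = s≤s⁻¹ (*-cancelʳ-< (12 * c) _ _ (begin-strict
      degree A u * (12 * c)  ≡⟨ *-comm (degree A u) (12 * c) ⟩
      12 * c * degree A u    ≤⟨ low u<n ⟩
      m                      <⟨ m<1+[m/n]*n m (12 * c) ⟩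
      suc D * (12 * c)       ∎))
      where open ≤-Reasoning

    volume≤w : ∀ p → volume A (level block p) ≤ w
    volume≤w p = s≤s⁻¹ (weight<W+D p n degree≤D)

    -- Here `w` is at most m/6c + m/12c = m/4c. Two windows of volume `w` spoil up to `4 * w` arcs,
    -- so one colour spoils at most m/c.
    4cw≤m : c * (4 * w) ≤ m
    4cw≤m = *-cancelˡ-≤ 3 (begin
      3 * (c * (4 * w))                   ≡⟨ lemma c (m / M) D ⟩
      2 * (m / M * M) + D * (12 * c)      ≤⟨ +-mono-≤ (*-monoʳ-≤ 2 (m/n*n≤m m M)) (m/n*n≤m m (12 * c)) ⟩
      2 * m + m                           ≡⟨ lemma′ m ⟩
      3 * m                               ∎)
      where
      open ≤-Reasoning
      lemma : ∀ c x y → 3 * (c * (4 * (x + y))) ≡ 2 * (x * (6 * c)) + y * (12 * c)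
      lemma = solve-∀
      lemma′ : ∀ m → 2 * m + m ≡ 3 * m
      lemma′ = solve-∀

    -- The factor `c` in `c * κ ≤ m` cancels; `4 * 9` stands for `6 * 6`, from the square of `M`.
    κ-bound : ∀ x → 4 * m ≤ c * (4 * 9 * (c * c) * x) → κ ≤ 9 * (c * c) * x
    κ-bound x h = *-cancelˡ-≤ c (*-cancelˡ-≤ 4 (begin
      4 * (c * κ)                 ≤⟨ *-monoʳ-≤ 4 many ⟩
      4 * m                       ≤⟨ h ⟩
      c * (4 * 9 * (c * c) * x)      ≡⟨ lemma 4 9 c x ⟩
      4 * (c * (9 * (c * c) * x)) ∎))
      where
      open ≤-Reasoning
      lemma : ∀ a b c x → c * (a * b * (c * c) * x) ≡ a * (c * (b * (c * c) * x))
      lemma = solve-∀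

    2≤M : 2 ≤ M
    2≤M = ≤-trans (m≤m+n 2 4) (m≤m*n 6 c)

    -- Painting one pair of windows costs at most one share of m/c.
    rest : ∀ U t p q → suc (suc t) * m ≤ c * arcs A U →
           suc t * m ≤ c * arcs A (U ∖ (level block p ∪ level block q))
    rest U t p q big = +-cancelˡ-≤ m _ _ (begin
      suc (suc t) * m                      ≤⟨ big ⟩
      c * arcs A U                         ≤⟨ *-monoʳ-≤ c (arcs-∖ adjacency U S) ⟩
      c * (arcs A (U ∖ S) + 2 * volume A S)
        ≤⟨ *-monoʳ-≤ c (+-monoʳ-≤ (arcs A (U ∖ S)) (*-monoʳ-≤ 2
             (≤-trans (volume-∪ A (level block p) (level block q)) (+-mono-≤ (volume≤w p) (volume≤w q))))) ⟩
      c * (arcs A (U ∖ S) + 2 * (w + w))   ≡⟨ lemma c (arcs A (U ∖ S)) w ⟩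
      c * (4 * w) + c * arcs A (U ∖ S)     ≤⟨ +-monoˡ-≤ (c * arcs A (U ∖ S)) 4cw≤m ⟩
      m + c * arcs A (U ∖ S)               ∎)
      where
      open ≤-Reasoning
      S : VertexSet
      S = level block p ∪ level block q
      lemma : ∀ c x w → c * (x + 2 * (w + w)) ≡ c * (4 * w) + c * x
      lemma = solve-∀

    -- Only vertices of `S` are repainted, so colours found in `U` outside `S` keep their arcs,
    -- while the new colour gets the arcs of `U` inside `S`.
    step : ∀ t U (S : VertexSet) g h → suc (suc t) * m ≤ c * arcs A U →
      2 * arcs A U ≤ M * (M * arcs A (U ∩ S)) →
      (∀ {i} → i ≤ t → κ ≤ 9 * (c * c) * arcs A ((U ∖ S) ∩ level (colour t g) i)) →
      (∀ {u} → u < n → colour (suc t) h u ≡ (if S u then suc t else colour t g u)) →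
      ∀ {i} → i ≤ suc t → κ ≤ 9 * (c * c) * arcs A (U ∩ level (colour (suc t) h) i)
    step t U S g h big heavy IH eq = loads
      where
      open ≤-Reasoning
      keep : ∀ {i u} → u < n → ((U ∖ S) ∩ level (colour t g) i) u ≡ true →
             (U ∩ level (colour (suc t) h) i) u ≡ true
      keep {i} {u} u<n e rewrite eq u<n with U u | S u
      ... | true | false = e
      paint : ∀ {u} → u < n → (U ∩ S) u ≡ true → (U ∩ level (colour (suc t) h) (suc t)) u ≡ true
      paint {u} u<n e rewrite eq u<n with U u | S u
      ... | true | true = ≡ᵇ-refl t
      loads : ∀ {i} → i ≤ suc t → κ ≤ 9 * (c * c) * arcs A (U ∩ level (colour (suc t) h) i)
      loads {i} i≤1+t with m≤n⇒m<n∨m≡n i≤1+t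
      ... | inj₁ i<1+t = ≤-trans (IH (s≤s⁻¹ i<1+t)) (*-monoʳ-≤ (9 * (c * c))
              (arcs-mono A A ((U ∖ S) ∩ level (colour t g) i) (U ∩ level (colour (suc t) h) i)
                λ u<n v<n a x y → a , keep {i} u<n x , keep {i} v<n y))
      ... | inj₂ refl = ≤-trans (κ-bound (arcs A (U ∩ S)) (begin
              -- At least two shares of m/c are left in `U`, which is why the factor is
              -- `9 * (c * c)` and not twice as much.
              4 * m                              ≤⟨ m≤m+n (4 * m) (2 * (t * m)) ⟩
              4 * m + 2 * (t * m)                ≡⟨ lemma₁ m t ⟩
              2 * (suc (suc t) * m)              ≤⟨ *-monoʳ-≤ 2 big ⟩
              2 * (c * arcs A U)                 ≡⟨ lemma₂ c (arcs A U) ⟩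
              c * (2 * arcs A U)                 ≤⟨ *-monoʳ-≤ c heavy ⟩
              c * (M * (M * arcs A (U ∩ S)))     ≡⟨ lemma₃ 6 c (arcs A (U ∩ S)) ⟩
              c * (4 * 9 * (c * c) * arcs A (U ∩ S)) ∎))
            (*-monoʳ-≤ (9 * (c * c)) (arcs-mono A A (U ∩ S) (U ∩ level (colour (suc t) h) (suc t))
              λ u<n v<n a x y → a , paint u<n x , paint v<n y))
        where
        lemma₁ : ∀ m t → 4 * m + 2 * (t * m) ≡ 2 * (suc (suc t) * m)
        lemma₁ = solve-∀
        lemma₂ : ∀ c x → 2 * (c * x) ≡ c * (2 * x)
        lemma₂ = solve-∀
        lemma₃ : ∀ s c x → c * (s * c * (s * c * x)) ≡ c * (s * s * (c * c) * x)
        lemma₃ = solve-∀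

    -- The highest colour chooses its windows first. The set `U` is what the higher colours have not
    -- spoilt, and it retains one share of m/c for each of the `suc t` colours left; colour 0 takes
    -- the remainder.
    lowDegree : ∀ t U → suc t * m ≤ c * arcs A U →
      ∃[ g ] Bounded n g × (∀ {i} → i ≤ t → κ ≤ 9 * (c * c) * arcs A (U ∩ level (colour t g) i))
    lowDegree zero    U big = const 0 , (λ _ → z≤n) , λ { z≤n → κ-bound _ (begin
      4 * m                                              ≤⟨ *-monoʳ-≤ 4 (subst (_≤ c * arcs A U) (+-identityʳ m) big) ⟩
      4 * (c * arcs A U)                                 ≤⟨ *-monoˡ-≤ (c * arcs A U)
                                                              (≤-trans (m≤m+n 4 32) (m≤m*n (4 * 9) (c * c) {{m*n≢0 c c}})) ⟩
      4 * 9 * (c * c) * (c * arcs A U)                      ≡⟨ lemma (4 * 9 * (c * c)) c (arcs A U) ⟩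
      c * (4 * 9 * (c * c) * arcs A U)                      ≡⟨ cong (λ x → c * (4 * 9 * (c * c) * x))
                                                              (∑²-cong λ {u} {v} _ _ → cong χ (cong (A u v ∧_)
                                                                (sym (cong₂ _∧_ (∧-identityʳ (U u)) (∧-identityʳ (U v)))))) ⟩
      c * (4 * 9 * (c * c) * arcs A (U ∩ full))             ∎) }
      where
      open ≤-Reasoning
      lemma : ∀ x y z → x * (y * z) ≡ y * (x * z)
      lemma = solve-∀
    lowDegree (suc t) U big =
      let p , q , heavy = heavyPair A U block M 2≤M block<M
          g , g≤n , IH  = lowDegree t (U ∖ (level block p ∪ level block q)) (rest U t p q big)
          h , h≤n , eq  = extend n t (level-isWindow block block-mono n p)
                                     (level-isWindow block block-mono n q) g≤n
      in h , h≤n , step t U (level block p ∪ level block q) g h big heavy IH eq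

-- High degree: a vertex with a block of its neighbours

delete : (ℕ → ℕ → Bool) → ℕ → (ℕ → ℕ → Bool)
delete A x u v = A u v ∧ not (x ≡ᵇ u) ∧ not (x ≡ᵇ v)

delete-adjacency : ∀ {A} → IsAdjacency A → ∀ x → IsAdjacency (delete A x)
delete-adjacency adjacency x = record
  { symmetric   = λ u v → cong₂ _∧_ (symmetric u v) (∧-comm (not (x ≡ᵇ u)) (not (x ≡ᵇ v)))
  ; irreflexive = λ v → cong (_∧ (not (x ≡ᵇ v) ∧ not (x ≡ᵇ v))) (irreflexive v)
  }
  where open IsAdjacency adjacency

module _ (n : ℕ) where
  open Arcs n

  -- The target `κ` counts arcs, that is, twice the edges, and `s` is the factor by which it may be
  -- missed.
  Dense : (ℕ → ℕ → Bool) → ℕ → (ℕ → ℕ) → ℕ → ℕ → Set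
  Dense A s f j κ = ∀ {i} → i ≤ j → κ ≤ s * arcs A (level f i)

  -- Deleting x spoils at most one of the colours 0 , … , j + 1; that colour
  -- is renamed to j + 1.

  module Delete (A : ℕ → ℕ → Bool) (x j : ℕ) (ψ : ℕ → ℕ) where

    rename : ℕ → ℕ
    rename u = if ψ u ≡ᵇ suc j then ψ x else if ψ u ≡ᵇ ψ x then suc j else ψ u

    dense : ∀ {κ} → Dense A 1 ψ (suc j) κ → Dense (delete A x) 1 rename j κ
    dense {κ} ψ-dense {i} i≤j = from (i ≟ ψ x)
      where
      open ≤-Reasoning
      keep : ∀ {i′} → (∀ u → ψ u ≡ i′ → x ≢ u × rename u ≡ i) →
             arcs A (level ψ i′) ≤ arcs (delete A x) (level rename i)
      keep {i′} h = arcs-mono A (delete A x) (level ψ i′) (level rename i) λ {u} {v} _ _ a p q →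
        let x≢u , ru = h u (sym (≡ᵇ-true {i′} p))
            x≢v , rv = h v (sym (≡ᵇ-true {i′} q))
        in trans (cong₂ _∧_ a (cong₂ (λ b c → not b ∧ not c) (≢⇒≡ᵇ x≢u) (≢⇒≡ᵇ x≢v))) refl
           , trans (cong (i ≡ᵇ_) ru) (≡ᵇ-refl i) , trans (cong (i ≡ᵇ_) rv) (≡ᵇ-refl i)
      from : Dec (i ≡ ψ x) → κ ≤ 1 * arcs (delete A x) (level rename i)
      -- The new class `ψ x` is the old class `suc j`, which avoids `x` since `ψ x` is at most `j`
      -- here.
      from (yes refl) = ≤-trans (ψ-dense ≤-refl) (*-monoʳ-≤ 1 (keep last))
        where
        last : ∀ u → ψ u ≡ suc j → x ≢ u × rename u ≡ ψ x
        last u e = (λ { refl → <⇒≢ (s≤s i≤j) e }) , lemma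
          where
          lemma : rename u ≡ ψ x
          lemma rewrite e | ≡ᵇ-refl j = refl
      from (no i≢ψx) = ≤-trans (ψ-dense (m≤n⇒m≤1+n i≤j)) (*-monoʳ-≤ 1 (keep same))
        where
        same : ∀ u → ψ u ≡ i → x ≢ u × rename u ≡ i
        same u refl = (λ { refl → i≢ψx refl }) , lemma
          where
          lemma : rename u ≡ ψ u
          lemma rewrite ≢⇒≡ᵇ (<⇒≢ (s≤s i≤j)) | ≢⇒≡ᵇ i≢ψx = refl

  module Star {A} (adjacency : IsAdjacency A) (j κ x s : ℕ) .{{_ : NonZero s}} (x<n : x < n)
              (many  : suc (suc j * 3) * s ≤ degree A x)
              (large : κ ≤ ratio (suc j) * (2 * s)) where
    -- The weight of a block is the number of neighbours of `x` in it.
    open Blocks (λ u → χ (A x u)) s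

    χ≤1 : ∀ b → χ b ≤ 1
    χ≤1 false = z≤n
    χ≤1 true  = ≤-refl

    -- The weights are 0 or 1, so a block is closed at exactly `s` neighbours, and by `many` there
    -- are enough neighbours to fill all these blocks.
    leaves : ∀ q → q < suc (suc j * 3) → s ≤ weight q n
    leaves q q<M = +-cancelʳ-≤ (q * s) s _ (begin
      suc q * s                  ≡⟨ m≥n⇒m⊓n≡n (≤-trans (*-monoˡ-≤ s q<M) many) ⟨
      prefix n ⊓ (suc q * s)     ≤⟨ weight-lower q n (λ u → χ≤1 (A x u)) ⟩
      weight q n + q * s         ∎)
      where open ≤-Reasoning

    -- An old colour loses at most half of its arcs to the light block, within the increase of the
    -- ratio. The new colour contains a star with centre `x` and at least `s` leaves, hence `2 * s`
    -- arcs.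
    recolour : ∀ g h q → q < suc (suc j * 3) →
      Dense (delete A x) (ratio j) (colour j g) j κ →
      (∀ {i} → i < suc j → arcs (delete A x) (level (colour j g) i) ≤
                           2 * arcs (delete A x) (level (colour j g) i ∖ level block q)) →
      (∀ {u} → u < n → colour (suc j) h u ≡ (if (x ≡ᵇ u) ∨ (q ≡ᵇ block u) then suc j else colour j g u)) →
      Dense A (ratio (suc j)) (colour (suc j) h) (suc j) κ
    recolour g h q q<M old light eq i≤1+j = loads (m≤n⇒m<n∨m≡n i≤1+j)
      where
      open ≤-Reasoning
      keep : ∀ {i u} → u < n → not (x ≡ᵇ u) ≡ true →
             (level (colour j g) i ∖ level block q) u ≡ true → level (colour (suc j) h) i u ≡ true
      keep {i} {u} u<n x≢u e rewrite eq u<n with x ≡ᵇ u | q ≡ᵇ block u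
      ... | false | false = trans (sym (∧-identityʳ _)) e
      ... | false | true  = contradiction (trans (sym e) (∧-zeroʳ _)) λ ()
      paint : ∀ {u} → u < n → ((x ≡ᵇ_) ∪ level block q) u ≡ true →
              level (colour (suc j) h) (suc j) u ≡ true
      paint {u} u<n e rewrite eq u<n with (x ≡ᵇ u) ∨ (q ≡ᵇ block u)
      ... | true = ≡ᵇ-refl j
      split : ∀ {a b c} → a ∧ b ∧ c ≡ true → a ≡ true × b ≡ true × c ≡ true
      split {true} {true} {true} _ = refl , refl , refl
      loads : ∀ {i} → i < suc j ⊎ i ≡ suc j →
              κ ≤ ratio (suc j) * arcs A (level (colour (suc j) h) i)
      loads {i} (inj₁ i<1+j) = begin
        κ
          ≤⟨ old (s≤s⁻¹ i<1+j) ⟩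
        ratio j * arcs (delete A x) (level (colour j g) i)
          ≤⟨ *-monoʳ-≤ (ratio j) (light i<1+j) ⟩
        ratio j * (2 * arcs (delete A x) (level (colour j g) i ∖ level block q))
          ≡⟨ *-assoc (ratio j) 2 _ ⟨
        ratio j * 2 * arcs (delete A x) (level (colour j g) i ∖ level block q)
          ≤⟨ *-mono-≤ (2*ratio≤ratio j) (arcs-mono (delete A x) A _ (level (colour (suc j) h) i) λ {u} {v} u<n v<n a p r →
               let auv , xu , xv = split {A u v} a in auv , keep {i} u<n xu p , keep {i} v<n xv r) ⟩
        ratio (suc j) * arcs A (level (colour (suc j) h) i)
          ∎
      loads (inj₂ refl) = begin
        κ
          ≤⟨ large ⟩
        ratio (suc j) * (2 * s)
          ≤⟨ *-monoʳ-≤ (ratio (suc j)) (*-monoʳ-≤ 2 (leaves q q<M)) ⟩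
        ratio (suc j) * (2 * weight q n)
          ≤⟨ *-monoʳ-≤ (ratio (suc j)) (star⇒arcs adjacency (level block q) x<n) ⟩
        ratio (suc j) * arcs A ((x ≡ᵇ_) ∪ level block q)
          ≤⟨ *-monoʳ-≤ (ratio (suc j)) (arcs-mono A A _ (level (colour (suc j) h) (suc j))
               λ u<n v<n a p r → a , paint u<n p , paint v<n r) ⟩
        ratio (suc j) * arcs A (level (colour (suc j) h) (suc j))
          ∎

    star : ∀ g → Bounded n g → Dense (delete A x) (ratio j) (colour j g) j κ →
           ∃[ h ] Bounded n h × Dense A (ratio (suc j)) (colour (suc j) h) (suc j) κ
    star g g≤n old =
      let q , q<M , light = lightBlock (delete-adjacency adjacency x) block (suc j) (level (colour j g))
          h , h≤n , eq    = extend n j (singleton-isWindow x<n) (level-isWindow block block-mono n q) g≤n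
      in h , h≤n , λ {i} → recolour g h q q<M old light eq {i}

  -- Induction on the number of colours

  -- The relation varies in the induction, since a vertex of high degree is deleted before the
  -- remaining colours are treated; the target `κ` stays the same.
  approximation : ∀ j {A} → IsAdjacency A → ∀ κ → 0 < κ → ∀ ψ → Dense A 1 ψ j κ →
                  ∃[ g ] Bounded n g × Dense A (ratio j) (colour j g) j κ
  approximation zero adjacency κ 0<κ ψ ψ-dense = const 0 , (λ _ → z≤n) , λ
    { z≤n → ≤-trans (ψ-dense z≤n) (*-monoʳ-≤ 1
        (arcs-mono _ _ (level ψ 0) full λ _ _ a _ _ → a , refl , refl)) }
  approximation (suc j) {A} adjacency κ 0<κ ψ ψ-dense =
    cases (κ ≤? 2 * R) (anyUpTo? (λ x → m <? 12 * c * degree A x) n)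
    where
    open ≤-Reasoning
    c R M m : ℕ
    c = 2 + j
    R = ratio (suc j)
    M = suc (suc j * 3)
    m = arcs A full
    Result : Set
    Result = ∃[ g ] Bounded n g × Dense A R (colour (suc j) g) (suc j) κ
    κ≤ : ∀ {i} → i < c → κ ≤ arcs A (level ψ i)
    κ≤ i<c = subst (κ ≤_) (*-identityˡ _) (ψ-dense (s≤s⁻¹ i<c))
    cκ≤m : c * κ ≤ m
    cκ≤m = begin
      c * κ                           ≡⟨ ∑-const c κ ⟨
      ∑[ i < c ] κ                    ≤⟨ ∑-mono c κ≤ ⟩
      ∑[ i < c ] arcs A (level ψ i)   ≤⟨ arcs-disjoint A ψ c ⟩
      m                               ∎
    -- A single edge already counts as two arcs, whence the limit `2 * R`.
    fewEdges : κ ≤ 2 * R → Result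
    fewEdges κ≤2R =
      let g , g≤n , edge = matching n adjacency ψ (suc j) λ {i} i≤1+j →
            let x , y , x<n , y<n , axy , px , py = 0<arcs⇒arc A (level ψ i) (<-≤-trans 0<κ (κ≤ (s≤s i≤1+j)))
                ψx = sym (≡ᵇ-true {i} px)
                ψy = sym (≡ᵇ-true {i} py)
            in x , y , x<n , y<n , axy , (ψx , ψx) , (ψy , ψy)
      in g , g≤n , λ {i} i≤1+j →
        let x , y , x<n , y<n , axy , (_ , cx) , (_ , cy) = edge i≤1+j
        in begin
          κ                                        ≤⟨ κ≤2R ⟩
          2 * R                                    ≡⟨ *-comm 2 R ⟩
          R * 2                                    ≤⟨ *-monoʳ-≤ R (edge⇒2≤arcs adjacency (level (colour (suc j) g) i) x<n y<n axy
                                                        (trans (cong (i ≡ᵇ_) cx) (≡ᵇ-refl i))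
                                                        (trans (cong (i ≡ᵇ_) cy) (≡ᵇ-refl i))) ⟩
          R * arcs A (level (colour (suc j) g) i)  ∎
    lowDegrees : (∀ {u} → u < n → 12 * c * degree A u ≤ m) → Result
    lowDegrees low =
      let open LowDegree n adjacency c κ cκ≤m low
          g , g≤n , dense = lowDegree (suc j) full ≤-refl
      in g , g≤n , λ i≤1+j → ≤-trans (dense i≤1+j) (*-monoˡ-≤ _ (ratio≥lowDegree j))
    highDegree : ∀ x → x < n → m < 12 * c * degree A x → 2 * R < κ → Result
    highDegree x x<n high 2R<κ =
      let g , g≤n , dense = approximation j (delete-adjacency adjacency x) κ 0<κ
                              (Delete.rename A x j ψ) (Delete.dense A x j ψ ψ-dense)
      in Star.star adjacency j κ x s {{>-nonZero s>0}} x<n many large g g≤n dense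
      where
      d s : ℕ
      d = degree A x
      s = d / M
      κ<12d : κ < 12 * d
      κ<12d = *-cancelˡ-< c κ (12 * d) (begin-strict
        c * κ          ≤⟨ cκ≤m ⟩
        m              <⟨ high ⟩
        12 * c * d     ≡⟨ lemma 12 c d ⟩
        c * (12 * d)   ∎)
        where
        lemma : ∀ a c d → a * c * d ≡ c * (a * d)
        lemma = solve-∀
      -- A target above `2 * R` forces `d` above `M`, so that every block gets a neighbour of `x`.
      s>0 : 0 < s
      s>0 = m≥n⇒m/n>0 (<⇒≤ (*-cancelˡ-< 12 M d (begin-strict
        12 * M    ≤⟨ ratio≥star j ⟩
        R         ≤⟨ m≤m+n R _ ⟩
        2 * R     <⟨ 2R<κ ⟩
        κ         <⟨ κ<12d ⟩
        12 * d    ∎)))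
      many : M * s ≤ d
      many = subst (_≤ d) (*-comm s M) (m/n*n≤m d M)
      large : κ ≤ R * (2 * s)
      large = begin
        κ                   ≤⟨ <⇒≤ κ<12d ⟩
        12 * d              ≤⟨ *-monoʳ-≤ 12 (<⇒≤ (m<1+[m/n]*n d M)) ⟩
        -- As `s` is positive, `suc s` is at most `s + s`; this absorbs the rounding in `d / M`.
        12 * (suc s * M)    ≤⟨ *-monoʳ-≤ 12 (*-monoˡ-≤ M (+-monoˡ-≤ s s>0)) ⟩
        12 * ((s + s) * M)  ≡⟨ lemma 12 s M ⟩
        12 * M * (2 * s)    ≤⟨ *-monoˡ-≤ (2 * s) (ratio≥star j) ⟩
        R * (2 * s)         ∎
        where
        lemma : ∀ a s M → a * ((s + s) * M) ≡ a * M * (2 * s)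
        lemma = solve-∀
    cases : Dec (κ ≤ 2 * R) → Dec (∃[ x ] x < n × m < 12 * c * degree A x) → Result
    cases (yes κ≤2R) _                      = fewEdges κ≤2R
    cases (no  κ≰2R) (yes (x , x<n , high)) = highDegree x x<n high (≰⇒> κ≰2R)
    cases (no  _)    (no  none)             = lowDegrees λ u<n → ≮⇒≥ λ high → none (_ , u<n , high)

-- From graphs on `Fin n` to relations on numbers

∑ᴸ : ∀ {a} {X : Set a} → List X → (X → ℕ) → ℕ
∑ᴸ []       f = 0
∑ᴸ (x ∷ xs) f = f x + ∑ᴸ xs f

∑ᴸ-++ : ∀ {a} {X : Set a} (xs ys : List X) f → ∑ᴸ (xs ++ ys) f ≡ ∑ᴸ xs f + ∑ᴸ ys f
∑ᴸ-++ []       ys f = refl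
∑ᴸ-++ (x ∷ xs) ys f = trans (cong (f x +_) (∑ᴸ-++ xs ys f)) (sym (+-assoc (f x) _ _))

∑ᴸ-map : ∀ {a b} {X : Set a} {Y : Set b} (h : X → Y) xs f → ∑ᴸ (map h xs) f ≡ ∑ᴸ xs (f ∘ h)
∑ᴸ-map h []       f = refl
∑ᴸ-map h (x ∷ xs) f = cong (f (h x) +_) (∑ᴸ-map h xs f)

∑ᴸ-cartesianProduct : ∀ {a b} {X : Set a} {Y : Set b} (xs : List X) (ys : List Y) f →
  ∑ᴸ (cartesianProduct xs ys) f ≡ ∑ᴸ xs λ x → ∑ᴸ ys λ y → f (x , y)
∑ᴸ-cartesianProduct []       ys f = refl
∑ᴸ-cartesianProduct (x ∷ xs) ys f =
  trans (∑ᴸ-++ (map (x ,_) ys) _ f) (cong₂ _+_ (∑ᴸ-map (x ,_) ys f) (∑ᴸ-cartesianProduct xs ys f))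

∑-head : ∀ n f → ∑ (suc n) f ≡ f 0 + ∑ n (f ∘ suc)
∑-head zero    f = +-comm 0 (f 0)
∑-head (suc n) f = trans (cong (_+ f (suc n)) (∑-head n f)) (+-assoc (f 0) _ _)

∑ᴸ-tabulate : ∀ {a} {X : Set a} n (h : Fin n → X) {f g} → (∀ i → f (h i) ≡ g (toℕ i)) →
              ∑ᴸ (tabulate h) f ≡ ∑ n g
∑ᴸ-tabulate zero    h       f≗g = refl
∑ᴸ-tabulate (suc n) h {g = g} f≗g =
  trans (cong₂ _+_ (f≗g Fin.zero) (∑ᴸ-tabulate n (h ∘ Fin.suc) (f≗g ∘ Fin.suc))) (sym (∑-head n g))

length-filter-filter : ∀ {a p q} {X : Set a} {P : Pred X p} {Q : Pred X q}
  (P? : Decidable P) (Q? : Decidable Q) xs →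
  length (filter P? (filter Q? xs)) ≡ ∑ᴸ xs λ x → χ (does (Q? x) ∧ does (P? x))
length-filter-filter P? Q? [] = refl
length-filter-filter P? Q? (x ∷ xs) with does (Q? x)
... | false = length-filter-filter P? Q? xs
... | true with does (P? x)
...   | false = length-filter-filter P? Q? xs
...   | true  = cong suc (length-filter-filter P? Q? xs)

adjacent : ∀ {n} → Graph n → ℕ → ℕ → Bool
adjacent {n} G u v with u <? n | v <? n
... | yes u<n | yes v<n = adj G (fromℕ< u<n) (fromℕ< v<n)
... | yes _   | no _    = false
... | no  _   | _       = false

adjacent-isAdjacency : ∀ {n} (G : Graph n) → IsAdjacency (adjacent G)
adjacent-isAdjacency {n} G = record { symmetric = symmetric ; irreflexive = irreflexive }
  where
  symmetric : ∀ u v → adjacent G u v ≡ adjacent G v u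
  symmetric u v with u <? n | v <? n
  ... | yes u<n | yes v<n = symm G _ _
  ... | yes _   | no _    = refl
  ... | no  _   | yes _   = refl
  ... | no  _   | no  _   = refl
  irreflexive : ∀ v → adjacent G v v ≡ false
  irreflexive v with v <? n
  ... | yes v<n = irrefl G _
  ... | no  _   = refl

adjacent-toℕ : ∀ {n} (G : Graph n) u v → adjacent G (toℕ u) (toℕ v) ≡ adj G u v
adjacent-toℕ {n} G u v with toℕ u <? n | toℕ v <? n
... | yes u<n | yes v<n = cong₂ (adj G) (Fin.fromℕ<-toℕ u u<n) (Fin.fromℕ<-toℕ v v<n)
... | yes _   | no  v≮n = contradiction (Fin.toℕ<n v) v≮n
... | no  u≮n | _       = contradiction (Fin.toℕ<n u) u≮n

-- The address `n * u + v` is the value of `combine`, which `remQuot` inverts.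
adjacencyMatrix-adjacent : ∀ {n} (G : Graph n) {u v} → u < n → v < n →
                           adjacencyMatrix G (n * u + v) ≡ χ (adjacent G u v)
adjacencyMatrix-adjacent {n} G {u} {v} u<n v<n =
  subst₂ (λ x y → adjacencyMatrix G (n * x + y) ≡ χ (adjacent G x y))
         (Fin.toℕ-fromℕ< u<n) (Fin.toℕ-fromℕ< v<n) (onFin (fromℕ< u<n) (fromℕ< v<n))
  where
  onFin : ∀ x y → adjacencyMatrix G (n * toℕ x + toℕ y) ≡ χ (adjacent G (toℕ x) (toℕ y))
  onFin x y rewrite adjacent-toℕ G x y | sym (Fin.toℕ-combine x y) with toℕ (combine x y) <? n * n
  ... | no  ≮n²  = contradiction (Fin.toℕ<n (combine x y)) ≮n²
  ... | yes <n²  =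
    trans (cong (λ i → if uncurry (adj G) (remQuot n i) then 1 else 0) (Fin.fromℕ<-toℕ (combine x y) <n²))
      (trans (cong (λ p → if uncurry (adj G) p then 1 else 0) (Fin.remQuot-combine x y)) (if≡χ (adj G x y)))
    where
    if≡χ : ∀ b → (if b then 1 else 0) ≡ χ b
    if≡χ true  = refl
    if≡χ false = refl

-- Each edge counts once, by its pair with `u < v`, as in `edges` and in contrast to `arcs`.
loadBelow : ℕ → (ℕ → ℕ → Bool) → VertexSet → ℕ
loadBelow n A S = ∑[ u < n ] ∑[ v < n ] χ (((u <ᵇ v) ∧ A u v) ∧ S u ∧ S v)

load≡loadBelow : ∀ {n c} (G : Graph n) (φ : Fin n → Fin c) (f : ℕ → ℕ) →
                 (∀ u → toℕ (φ u) ≡ f (toℕ u)) → ∀ i →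
                 load G φ i ≡ loadBelow n (adjacent G) (level f (toℕ i))
load≡loadBelow {n} G φ f φ≗f i = trans (length-filter-filter (mono? φ i) _ (cartesianProduct (allFin n) (allFin n)))
  (trans (∑ᴸ-cartesianProduct (allFin n) (allFin n) _)
    (∑ᴸ-tabulate n id λ u → ∑ᴸ-tabulate n id λ v →
      cong χ (cong₂ _∧_ (cong ((toℕ u <ᵇ toℕ v) ∧_) (sym (adjacent-toℕ G u v)))
                        (cong₂ _∧_ (colour≡ u) (colour≡ v)))))
  where
  colour≡ : ∀ u → does (φ u Fin.≟ i) ≡ level f (toℕ i) (toℕ u)
  colour≡ u with φ u Fin.≟ i
  ... | yes refl = sym (trans (cong (toℕ i ≡ᵇ_) (sym (φ≗f u))) (≡ᵇ-refl (toℕ i)))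
  ... | no  ≢i   = sym (≢⇒≡ᵇ λ e → ≢i (Fin.toℕ-injective (trans (φ≗f u) (sym e))))

-- There are no loops, so an arc goes either up or down, and symmetry exchanges the two kinds.
arcs≡2*loadBelow : ∀ n {A} → IsAdjacency A → ∀ S → Arcs.arcs n A S ≡ 2 * loadBelow n A S
arcs≡2*loadBelow n {A} adjacency S = begin
  arcs A S
    ≡⟨ ∑²-cong (λ {u} {v} _ _ → split u v) ⟩
  ∑[ u < n ] ∑[ v < n ] (χ (((u <ᵇ v) ∧ A u v) ∧ S u ∧ S v) + χ (((v <ᵇ u) ∧ A v u) ∧ S v ∧ S u))
    ≡⟨ ∑²-distrib-+ _ _ ⟩
  loadBelow n A S + ∑[ u < n ] ∑[ v < n ] χ (((v <ᵇ u) ∧ A v u) ∧ S v ∧ S u)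
    ≡⟨ cong (loadBelow n A S +_) (trans (∑-comm n n _) (sym (+-identityʳ _))) ⟩
  2 * loadBelow n A S
    ∎
  where
  open ≡-Reasoning
  open Arcs n
  open IsAdjacency adjacency
  <ᵇ-asym : ∀ u v → u ≢ v → (v <ᵇ u) ≡ not (u <ᵇ v)
  <ᵇ-asym zero    zero    u≢v = contradiction refl u≢v
  <ᵇ-asym zero    (suc v) u≢v = refl
  <ᵇ-asym (suc u) zero    u≢v = refl
  <ᵇ-asym (suc u) (suc v) u≢v = <ᵇ-asym u v (u≢v ∘ cong suc)
  <ᵇ-irrefl : ∀ u → (u <ᵇ u) ≡ false
  <ᵇ-irrefl zero    = refl
  <ᵇ-irrefl (suc u) = <ᵇ-irrefl u
  split : ∀ u v → χ (A u v ∧ S u ∧ S v) ≡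
                  χ (((u <ᵇ v) ∧ A u v) ∧ S u ∧ S v) + χ (((v <ᵇ u) ∧ A v u) ∧ S v ∧ S u)
  split u v with u ≟ v
  ... | yes refl rewrite irreflexive u | <ᵇ-irrefl u = refl
  ... | no  u≢v rewrite <ᵇ-asym u v u≢v | symmetric v u | ∧-comm (S v) (S u) with u <ᵇ v
  ...   | true  = sym (+-identityʳ _)
  ...   | false = refl

-- Program rules with time bounds

Terminates : Program → Store → ℕ → (Store → Set) → Set
Terminates p σ B Q = ∃[ τ ] ∃[ t ] (p , σ ⇓ τ , t) × t ≤ B × Q τ

seq : ∀ {p q σ B C Q R} → Terminates p σ B Q → (∀ {τ} → Q τ → Terminates q τ C R) →
      Terminates (p ⨾ q) σ (B + C) R
seq (τ , s , p⇓ , s≤B , Qτ) q-spec =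
  let υ , t , q⇓ , t≤C , Rυ = q-spec Qτ
  in υ , s + t , ⇓seq p⇓ q⇓ , +-mono-≤ s≤B t≤C , Rυ

assign : ∀ {r e σ} {Q : Store → Set} → Q (store (regs σ [ r ↦ ⟦ e ⟧ σ ]) (cells σ)) →
         Terminates (r := e) σ (suc (cost e)) Q
assign q = _ , _ , ⇓assign , ≤-refl , q

for : ℕ → Expr → Program → Program
for r e p = r := lit 0 ⨾ while (e ⊖ reg r) (p ⨾ r := reg r ⊕ lit 1)

-- Each test of the loop costs `cost e + 3`, the increment of the counter 4, and its initialisation
-- 2.
forCost : ℕ → Expr → ℕ → ℕ
forCost L e B = 2 + (L * (B + (cost e + 7)) + (cost e + 3))

module _ {r e p} (L B : ℕ) (I : ℕ → Store → Set)
         (counter : ∀ {i τ} → I i τ → ⟦ e ⟧ τ ≡ L × regs τ r ≡ i)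
         (body    : ∀ {i τ} → i < L → I i τ →
                    Terminates p τ B λ υ → I (suc i) (store (regs υ [ r ↦ regs υ r + 1 ]) (cells υ)))
         where

  -- Induction on the number `m` of rounds left. The hypothesis `counter` ties the loop test to it,
  -- and `body` promises the invariant only after the increment.
  while-rule : ∀ m {i τ} → m + i ≡ L → I i τ →
               Terminates (while (e ⊖ reg r) (p ⨾ r := reg r ⊕ lit 1)) τ
                          (m * (B + (cost e + 7)) + (cost e + 3)) (I L)
  while-rule zero {i} {τ} refl Iτ =
    τ , _ , ⇓exit exit , ≤-reflexive (lemma (cost e)) , Iτ
    where
    exit : ⟦ e ⟧ τ ∸ regs τ r ≡ 0
    exit = trans (cong₂ _∸_ (proj₁ (counter Iτ)) (proj₂ (counter Iτ))) (n∸n≡0 i)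
    lemma : ∀ x → suc (suc (x + 1)) ≡ x + 3
    lemma = solve-∀
  while-rule (suc m) {i} {τ} m+i≡L Iτ =
    let υ , s , p⇓ , s≤B , Iυ = body (≤-trans (s≤s (m≤n+m i m)) (≤-reflexive m+i≡L)) Iτ
        ω , t , w⇓ , t≤  , Iω = while-rule m (trans (+-suc m i) m+i≡L) Iυ
    in ω , _ , ⇓loop continue (⇓seq p⇓ ⇓assign) w⇓ , bound s≤B t≤ , Iω
    where
    continue : ⟦ e ⟧ τ ∸ regs τ r ≢ 0
    continue rewrite proj₁ (counter Iτ) | proj₂ (counter Iτ) | sym m+i≡L | m+n∸n≡m (suc m) i = λ ()
    lemma : ∀ x s t → suc (suc (x + 1) + (s + 4) + t) ≡ s + (x + 7) + t
    lemma = solve-∀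
    bound : ∀ {s t} → s ≤ B → t ≤ m * (B + (cost e + 7)) + (cost e + 3) →
            suc (suc (cost e + 1) + (s + 4) + t) ≤ suc m * (B + (cost e + 7)) + (cost e + 3)
    bound {s} {t} s≤B t≤ = begin
      suc (suc (cost e + 1) + (s + 4) + t)                                      ≡⟨ lemma (cost e) s t ⟩
      s + (cost e + 7) + t                                                      ≤⟨ +-mono-≤ (+-monoˡ-≤ (cost e + 7) s≤B) t≤ ⟩
      B + (cost e + 7) + (m * (B + (cost e + 7)) + (cost e + 3))                ≡⟨ +-assoc (B + (cost e + 7)) _ _ ⟨
      suc m * (B + (cost e + 7)) + (cost e + 3)                                 ∎
      where open ≤-Reasoning

  for-rule : ∀ {σ} → I 0 (store (regs σ [ r ↦ 0 ]) (cells σ)) → Terminates (for r e p) σ (forCost L e B) (I L)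
  for-rule I₀ = seq {Q = I 0} (assign I₀) (while-rule L (+-identityʳ L))

-- Tests as arithmetic expressions

-- In the tests a value 0 stands for truth, so that conjunctions are sums.

1∸≡χ : ∀ x → 1 ∸ x ≡ χ (x ≡ᵇ 0)
1∸≡χ zero    = refl
1∸≡χ (suc x) = 0∸n≡0 x

+≡ᵇ0 : ∀ x y → (x + y ≡ᵇ 0) ≡ (x ≡ᵇ 0) ∧ (y ≡ᵇ 0)
+≡ᵇ0 zero    y = refl
+≡ᵇ0 (suc x) y = refl

∸≡ᵇ0 : ∀ x y → (x ∸ y ≡ᵇ 0) ≡ (x ≤ᵇ y)
∸≡ᵇ0 zero    zero    = refl
∸≡ᵇ0 zero    (suc y) = refl
∸≡ᵇ0 (suc x) zero    = refl
∸≡ᵇ0 (suc zero)    (suc y) = cong (_≡ᵇ 0) (0∸n≡0 y)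
∸≡ᵇ0 (suc (suc x)) (suc y) = ∸≡ᵇ0 (suc x) y

<ᵇ≡not-≤ᵇ : ∀ x y → (x <ᵇ y) ≡ not (y ≤ᵇ x)
<ᵇ≡not-≤ᵇ x       zero          = refl
<ᵇ≡not-≤ᵇ zero    (suc y)       = refl
<ᵇ≡not-≤ᵇ (suc x) (suc zero)    = refl
<ᵇ≡not-≤ᵇ (suc x) (suc (suc y)) = <ᵇ≡not-≤ᵇ x (suc y)

+1∸≡ᵇ0 : ∀ x y → (x + 1 ∸ y ≡ᵇ 0) ≡ (x <ᵇ y)
+1∸≡ᵇ0 x y = trans (cong (λ z → z ∸ y ≡ᵇ 0) (+-comm x 1)) (∸≡ᵇ0 (suc x) y)

-- Here and in `paintedE` a positive value means membership, the opposite of the convention for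
-- tests.
windowE : ℕ → ℕ → Expr → Expr
windowE a b x = lit 1 ⊖ ((reg a ⊖ x) ⊕ (x ⊕ lit 1 ⊖ reg b))

windowE-value : ∀ a b x σ → ⟦ windowE a b x ⟧ σ ≡ χ (window (regs σ a) (regs σ b) (⟦ x ⟧ σ))
windowE-value a b x σ = trans (1∸≡χ (regs σ a ∸ u + (u + 1 ∸ regs σ b)))
  (cong χ (trans (+≡ᵇ0 (regs σ a ∸ u) (u + 1 ∸ regs σ b))
    (cong₂ _∧_ (∸≡ᵇ0 (regs σ a) u) (trans (+1∸≡ᵇ0 u (regs σ b)) (<ᵇ≡not-≤ᵇ u (regs σ b))))))
  where
  u : ℕ
  u = ⟦ x ⟧ σ

paintedE : ℕ → Expr → Expr
paintedE b x = windowE (b + 0) (b + 1) x ⊕ windowE (b + 2) (b + 3) x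

-- The value is 0 exactly if the vertex `x` has colour `i`. The colours are compared while the
-- expression is built, so that none of this is left to the machine.
missE : ℕ → ℕ → ℕ → Expr → Expr
missE zero    zero    b x = lit 0
missE zero    (suc i) b x = lit 1
missE (suc j) i       b x =
  if i ≡ᵇ suc j then lit 1 ⊖ paintedE b x else paintedE b x ⊕ missE j i (b + 4) x

paintedE-value : ∀ {b σ g} x → (∀ r → regs σ (b + r) ≡ g r) →
                 (⟦ paintedE b x ⟧ σ ≡ᵇ 0) ≡ not (painted g (⟦ x ⟧ σ))
paintedE-value {b} {σ} {g} x σ≗g
  rewrite windowE-value (b + 0) (b + 1) x σ | windowE-value (b + 2) (b + 3) x σ
        | σ≗g 0 | σ≗g 1 | σ≗g 2 | σ≗g 3 =
  χ+χ (window (g 0) (g 1) (⟦ x ⟧ σ)) (window (g 2) (g 3) (⟦ x ⟧ σ))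
  where
  χ+χ : ∀ p q → (χ p + χ q ≡ᵇ 0) ≡ not (p ∨ q)
  χ+χ false false = refl
  χ+χ false true  = refl
  χ+χ true  q     = refl

missE-value : ∀ j i {b σ g} x → (∀ r → regs σ (b + r) ≡ g r) →
              (⟦ missE j i b x ⟧ σ ≡ᵇ 0) ≡ level (colour j g) i (⟦ x ⟧ σ)
missE-value zero    zero    x σ≗g = refl
missE-value zero    (suc i) x σ≗g = refl
missE-value (suc j) i {b} {σ} {g} x σ≗g with i ≡ᵇ suc j in eq
... | true with refl ← ≡ᵇ-true {i} eq =
  trans (1∸ (⟦ paintedE b x ⟧ σ)) (trans (cong not (paintedE-value x σ≗g)) (lemma (painted g u)))
  where
  u : ℕ
  u = ⟦ x ⟧ σ
  1∸ : ∀ z → (1 ∸ z ≡ᵇ 0) ≡ not (z ≡ᵇ 0)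
  1∸ zero    = refl
  1∸ (suc z) = cong (_≡ᵇ 0) (0∸n≡0 z)
  lemma : ∀ p → not (not p) ≡ (suc j ≡ᵇ (if p then suc j else colour j (λ r → g (4 + r)) u))
  lemma true  = sym (≡ᵇ-refl j)
  lemma false = sym (≢⇒≡ᵇ (≢-sym (<⇒≢ (s≤s (colour≤ j _ u)))))
... | false =
  trans (+≡ᵇ0 (⟦ paintedE b x ⟧ σ) _)
    (trans (cong₂ _∧_ (paintedE-value x σ≗g)
                      (missE-value j i x λ r → trans (cong (regs σ) (+-assoc b 4 r)) (σ≗g (4 + r))))
           (lemma (painted g u)))
  where
  u : ℕ
  u = ⟦ x ⟧ σ
  lemma : ∀ p → not p ∧ (i ≡ᵇ colour j (λ r → g (4 + r)) u) ≡
                (i ≡ᵇ (if p then suc j else colour j (λ r → g (4 + r)) u))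
  lemma true  = sym eq
  lemma false = refl

-- The search program and its cost

-- Registers: 0 holds n, 1 and 2 the vertices u and v, 3 the address
-- n * u + v, 4 the load of one colour, 5 the minimal load, 6 the best minimal
-- load so far, 7 , 8 , … the guesses.

edgeE : ℕ → ℕ → Expr
edgeE j i =
  lit 1 ⊖ (missE j i 7 (reg 1) ⊕ missE j i 7 (reg 2) ⊕ (lit 1 ⊖ mem (reg 3)) ⊕ (reg 1 ⊕ lit 1 ⊖ reg 2))

-- Row by row, register 3 runs through the addresses by increments, as the machine has no
-- multiplication.
countLoad : ℕ → ℕ → Program
countLoad j i = 4 := lit 0 ⨾ 3 := lit 0 ⨾
  for 1 (reg 0) (for 2 (reg 0) (4 := reg 4 ⊕ edgeE j i ⨾ 3 := reg 3 ⊕ lit 1))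

minLoad : ℕ → ℕ → Program
minLoad j zero    = countLoad j 0 ⨾ 5 := reg 4
-- Truncated subtraction expresses the minimum, and in `evaluate` the maximum.
minLoad j (suc i) = minLoad j i ⨾ countLoad j (suc i) ⨾ 5 := reg 5 ⊖ (reg 5 ⊖ reg 4)

evaluate : ℕ → Program
evaluate j = minLoad j j ⨾ 6 := reg 6 ⊕ (reg 5 ⊖ reg 6)

search : ℕ → ℕ → Program
search j zero    = evaluate j
-- The loop has `n + 1` rounds because a window may end at `n`.
search j (suc d) = for (7 + d) (lit 1 ⊕ reg 0) (search j d)

countCost : ℕ → ℕ → ℕ → ℕ
countCost j i n =
  2 + (2 + forCost n (reg 0) (forCost n (reg 0) (suc (cost (reg 4 ⊕ edgeE j i)) + 4)))

minCost : ℕ → ℕ → ℕ → ℕ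
minCost j zero    n = countCost j 0 n + 2
minCost j (suc i) n = minCost j i n + (countCost j (suc i) n + 6)

evaluateCost : ℕ → ℕ → ℕ
evaluateCost j n = minCost j j n + 6

searchCost : ℕ → ℕ → ℕ → ℕ
searchCost j zero    n = evaluateCost j n
searchCost j (suc d) n = forCost (suc n) (lit 1 ⊕ reg 0) (searchCost j d n)

-- Correctness of the program

_◂_ : ℕ → (ℕ → ℕ) → ℕ → ℕ
(x ◂ R) zero    = x
(x ◂ R) (suc r) = R r

m∸[m∸n]≡m⊓n : ∀ m n → m ∸ (m ∸ n) ≡ m ⊓ n
m∸[m∸n]≡m⊓n m n with ≤-total m n
... | inj₁ m≤n = trans (cong (m ∸_) (m≤n⇒m∸n≡0 m≤n)) (sym (m≤n⇒m⊓n≡m m≤n))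
... | inj₂ n≤m = trans (m∸[m∸n]≡n n≤m) (sym (m≥n⇒m⊓n≡n n≤m))

m+[n∸m]≡m⊔n : ∀ m n → m + (n ∸ m) ≡ m ⊔ n
m+[n∸m]≡m⊔n m n with ≤-total m n
... | inj₁ m≤n = trans (m+[n∸m]≡n m≤n) (sym (m≤n⇒m⊔n≡n m≤n))
... | inj₂ n≤m = trans (cong (m +_) (m≤n⇒m∸n≡0 n≤m)) (trans (+-identityʳ m) (sym (m≥n⇒m⊔n≡m n≤m)))

module _ (n : ℕ) (A : ℕ → ℕ → Bool) (matrix : ℕ → ℕ)
         (matrix≡A : ∀ {u v} → u < n → v < n → matrix (n * u + v) ≡ χ (A u v)) where

  -- Besides the input, this fixes the registers from `k` on; those between 0 and `k` are free for
  -- scratch work.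
  Frame : ℕ → (ℕ → ℕ) → Store → Set
  Frame k R σ = cells σ ≡ matrix × regs σ 0 ≡ n × (∀ r → regs σ (k + r) ≡ R r)

  minScore : ℕ → ℕ → (ℕ → ℕ) → ℕ
  minScore j zero    g = loadBelow n A (level (colour j g) 0)
  minScore j (suc i) g = minScore j i g ⊓ loadBelow n A (level (colour j g) (suc i))

  score : ℕ → (ℕ → ℕ) → ℕ
  score j g = minScore j j g

  edgeE-value : ∀ j i {σ R u v} → Frame 5 R σ → regs σ 1 ≡ u → regs σ 2 ≡ v → regs σ 3 ≡ n * u + v →
                u < n → v < n → let S = level (colour j (λ r → R (2 + r))) i in
                ⟦ edgeE j i ⟧ σ ≡ χ (((u <ᵇ v) ∧ A u v) ∧ S u ∧ S v)
  edgeE-value j i {σ} {R} (refl , _ , σ≗R) refl refl addr u<n v<n =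
    trans (1∸≡χ (z₁ + z₂ + z₃ + z₄)) (cong χ (trans (+≡ᵇ0 (z₁ + z₂ + z₃) z₄)
      (trans (cong (_∧ (z₄ ≡ᵇ 0)) (trans (+≡ᵇ0 (z₁ + z₂) z₃) (cong (_∧ (z₃ ≡ᵇ 0)) (+≡ᵇ0 z₁ z₂))))
      (trans (cong₂ _∧_ (cong₂ _∧_ (cong₂ _∧_ (missE-value j i (reg 1) (λ r → σ≗R (2 + r)))
                                               (missE-value j i (reg 2) (λ r → σ≗R (2 + r))))
                                   (trans (cong (λ x → 1 ∸ x ≡ᵇ 0)
                                            (trans (cong (cells σ) addr) (matrix≡A u<n v<n)))
                                          (1∸χ (A (regs σ 1) (regs σ 2)))))
                        (+1∸≡ᵇ0 (regs σ 1) (regs σ 2)))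
        (boolean (S (regs σ 1)) (S (regs σ 2)) (A (regs σ 1) (regs σ 2)) (regs σ 1 <ᵇ regs σ 2))))))
    where
    S : VertexSet
    S = level (colour j (λ r → R (2 + r))) i
    z₁ z₂ z₃ z₄ : ℕ
    z₁ = ⟦ missE j i 7 (reg 1) ⟧ σ
    z₂ = ⟦ missE j i 7 (reg 2) ⟧ σ
    z₃ = 1 ∸ cells σ (regs σ 3)
    z₄ = regs σ 1 + 1 ∸ regs σ 2
    1∸χ : ∀ a → (1 ∸ χ a ≡ᵇ 0) ≡ a
    1∸χ true  = refl
    1∸χ false = refl
    boolean : ∀ p q a l → ((p ∧ q) ∧ a) ∧ l ≡ (l ∧ a) ∧ p ∧ q
    boolean p q a l = trans (∧-comm ((p ∧ q) ∧ a) l)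
      (trans (cong (l ∧_) (∧-comm (p ∧ q) a)) (sym (∧-assoc l a (p ∧ q))))

  module _ (j i : ℕ) (R : ℕ → ℕ) where

    edge : ℕ → ℕ → ℕ
    edge u v = let S = level (colour j (λ r → R (2 + r))) i in χ (((u <ᵇ v) ∧ A u v) ∧ S u ∧ S v)

    InnerInv : ℕ → ℕ → Store → Set
    InnerInv u v σ = Frame 5 R σ × regs σ 1 ≡ u × regs σ 2 ≡ v × regs σ 3 ≡ n * u + v ×
                     regs σ 4 ≡ ∑[ x < u ] ∑[ y < n ] edge x y + ∑[ y < v ] edge u y

    OuterInv : ℕ → Store → Set
    OuterInv u σ = Frame 5 R σ × regs σ 1 ≡ u × regs σ 3 ≡ n * u ×
                   regs σ 4 ≡ ∑[ x < u ] ∑[ y < n ] edge x y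

    countLoad-spec : ∀ {σ} → Frame 5 R σ → Terminates (countLoad j i) σ (countCost j i n) λ τ →
      Frame 5 R τ × regs τ 4 ≡ loadBelow n A (level (colour j (λ r → R (2 + r))) i)
    countLoad-spec {σ} (cells≡ , r₀≡ , frame) =
      seq {Q = λ τ → Frame 5 R τ × regs τ 4 ≡ 0} (assign ((cells≡ , r₀≡ , frame) , refl))
      λ { {τ} ((cells≡ , r₀≡ , frame) , r₄≡) →
      seq {Q = λ τ → Frame 5 R τ × regs τ 4 ≡ 0 × regs τ 3 ≡ 0} (assign ((cells≡ , r₀≡ , frame) , r₄≡ , refl))
      λ { {τ} ((cells≡ , r₀≡ , frame) , r₄≡ , r₃≡) →
      weaken (for-rule n _ OuterInv (λ { ((_ , r₀≡ , _) , r₁≡ , _) → r₀≡ , r₁≡ }) outer {τ}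
        ((cells≡ , r₀≡ , frame) , refl , trans r₃≡ (sym (*-zeroʳ n)) , r₄≡)) } }
      where
      weaken : ∀ {p σ B} → Terminates p σ B (OuterInv n) → Terminates p σ B λ τ →
        Frame 5 R τ × regs τ 4 ≡ loadBelow n A (level (colour j (λ r → R (2 + r))) i)
      weaken (τ , t , p⇓ , t≤ , frame , _ , _ , r₄≡) = τ , t , p⇓ , t≤ , frame , r₄≡
      inner : ∀ {u v τ} → u < n → v < n → InnerInv u v τ →
        Terminates (4 := reg 4 ⊕ edgeE j i ⨾ 3 := reg 3 ⊕ lit 1) τ (suc (cost (reg 4 ⊕ edgeE j i)) + 4)
          λ υ → InnerInv u (suc v) (store (regs υ [ 2 ↦ regs υ 2 + 1 ]) (cells υ))
      inner {u} {v} {τ} u<n v<n (frame@(cells≡ , r₀≡ , frame₅) , r₁≡ , r₂≡ , r₃≡ , r₄≡) =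
        seq {Q = λ υ → Frame 5 R υ × regs υ 1 ≡ u × regs υ 2 ≡ v × regs υ 3 ≡ n * u + v ×
                 regs υ 4 ≡ ∑[ x < u ] ∑[ y < n ] edge x y + ∑[ y < suc v ] edge u y}
          (assign ((cells≡ , r₀≡ , frame₅) , r₁≡ , r₂≡ , r₃≡ ,
            trans (cong₂ _+_ r₄≡ (edgeE-value j i frame r₁≡ r₂≡ r₃≡ u<n v<n))
                  (+-assoc (∑[ x < u ] ∑[ y < n ] edge x y) _ _)))
          λ { ((cells≡ , r₀≡ , frame₅) , r₁≡ , r₂≡ , r₃≡ , r₄≡) →
            assign ((cells≡ , r₀≡ , frame₅) , r₁≡ , trans (cong (_+ 1) r₂≡) (+-comm v 1) ,
              trans (cong (_+ 1) r₃≡) (trans (+-assoc (n * u) v 1) (cong (n * u +_) (+-comm v 1))) , r₄≡) }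
      outer : ∀ {u τ} → u < n → OuterInv u τ →
        Terminates (for 2 (reg 0) (4 := reg 4 ⊕ edgeE j i ⨾ 3 := reg 3 ⊕ lit 1)) τ
          (forCost n (reg 0) (suc (cost (reg 4 ⊕ edgeE j i)) + 4))
          λ υ → OuterInv (suc u) (store (regs υ [ 1 ↦ regs υ 1 + 1 ]) (cells υ))
      outer {u} {τ} u<n ((cells≡ , r₀≡ , frame₅) , r₁≡ , r₃≡ , r₄≡) =
        next (for-rule n _ (InnerInv u) (λ { ((_ , r₀≡ , _) , _ , r₂≡ , _) → r₀≡ , r₂≡ }) (inner u<n) {τ}
          ((cells≡ , r₀≡ , frame₅) , r₁≡ , refl , trans r₃≡ (sym (+-identityʳ (n * u))) ,
           trans r₄≡ (sym (+-identityʳ _))))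
        where
        next : ∀ {p σ B} → Terminates p σ B (InnerInv u n) → Terminates p σ B
          λ υ → OuterInv (suc u) (store (regs υ [ 1 ↦ regs υ 1 + 1 ]) (cells υ))
        next (υ , t , p⇓ , t≤ , (cells≡ , r₀≡ , frame₅) , r₁≡ , r₂≡ , r₃≡ , r₄≡) =
          υ , t , p⇓ , t≤ , (cells≡ , r₀≡ , frame₅) , trans (cong (_+ 1) r₁≡) (+-comm u 1) ,
          trans r₃≡ (trans (+-comm (n * u) n) (sym (*-suc n u))) , r₄≡

  -- Adding the current value of register `k` to the frame shows that a subprogram working below `k`
  -- preserves it.
  expose : ∀ k {R} σ → Frame (suc k) R σ → Frame k (regs σ k ◂ R) σ
  expose k σ (cells≡ , r₀≡ , frame) = cells≡ , r₀≡ , λ where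
    zero    → cong (regs σ) (+-identityʳ k)
    (suc r) → trans (cong (regs σ) (+-suc k r)) (frame r)

  minLoad-spec : ∀ j i R {σ} → Frame 6 R σ → Terminates (minLoad j i) σ (minCost j i n) λ τ →
                 Frame 6 R τ × regs τ 5 ≡ minScore j i (λ r → R (suc r))
  minLoad-spec j zero R {σ} frame =
    seq (countLoad-spec j 0 (regs σ 5 ◂ R) (expose 5 σ frame)) λ { ((cells≡ , r₀≡ , frame) , r₄≡) →
      assign ((cells≡ , r₀≡ , λ r → frame (suc r)) , r₄≡) }
  minLoad-spec j (suc i) R frame =
    seq (minLoad-spec j i R frame) λ { {τ} (frame , r₅≡) →
      seq (countLoad-spec j (suc i) (regs τ 5 ◂ R) (expose 5 τ frame)) λ { ((cells≡ , r₀≡ , frame) , r₄≡) →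
        assign ((cells≡ , r₀≡ , λ r → frame (suc r)) ,
          trans (m∸[m∸n]≡m⊓n _ _) (cong₂ _⊓_ (trans (frame 0) r₅≡) r₄≡)) } }

  evaluate-spec : ∀ j g {σ} → Frame 7 g σ → Terminates (evaluate j) σ (evaluateCost j n) λ τ →
                  Frame 7 g τ × regs τ 6 ≡ regs σ 6 ⊔ score j g
  evaluate-spec j g {σ} frame =
    seq (minLoad-spec j j (regs σ 6 ◂ g) (expose 6 σ frame)) λ { {τ} ((cells≡ , r₀≡ , frame) , r₅≡) →
      assign ((cells≡ , r₀≡ , λ r → frame (suc r)) ,
        trans (m+[n∸m]≡m⊔n (regs τ 6) (regs τ 5)) (cong₂ _⊔_ (frame 0) r₅≡)) }

  minScore-cong : ∀ j i {g h} → (∀ {r} → r < j * 4 → g r ≡ h r) → minScore j i g ≡ minScore j i h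
  minScore-cong j i {g} {h} g≗h = go i
    where
    loads : ∀ i → loadBelow n A (level (colour j g) i) ≡ loadBelow n A (level (colour j h) i)
    loads i = Arcs.∑²-cong n λ {u} {v} _ _ →
      cong₂ (λ x y → χ (((u <ᵇ v) ∧ A u v) ∧ (i ≡ᵇ x) ∧ (i ≡ᵇ y))) (colour-cong j g≗h u) (colour-cong j g≗h v)
    go : ∀ i → minScore j i g ≡ minScore j i h
    go zero    = loads 0
    go (suc i) = cong₂ _⊓_ (go i) (loads (suc i))

  minScore≤ : ∀ j {i k} g → i ≤ k → minScore j k g ≤ loadBelow n A (level (colour j g) i)
  minScore≤ j {i} {zero}  g z≤n = ≤-refl
  minScore≤ j {i} {suc k} g i≤1+k with m≤n⇒m<n∨m≡n i≤1+k
  ... | inj₁ i<1+k = ≤-trans (m⊓n≤m _ _) (minScore≤ j g (s≤s⁻¹ i<1+k))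
  ... | inj₂ refl  = m⊓n≤n (minScore j k g) _

  minScore-attained : ∀ j i g (Q : ℕ → Set) → (∀ {k} → k ≤ i → Q (loadBelow n A (level (colour j g) k))) →
                      Q (minScore j i g)
  minScore-attained j zero    g Q q = q z≤n
  minScore-attained j (suc i) g Q q
    with ⊓-sel (minScore j i g) (loadBelow n A (level (colour j g) (suc i)))
  ... | inj₁ eq = subst Q (sym eq) (minScore-attained j i g Q (q ∘ m≤n⇒m≤1+n))
  ... | inj₂ eq = subst Q (sym eq) (q ≤-refl)

  module _ (j : ℕ) (P : ℕ → Set) (P-⊔ : ∀ {x} g → P x → P (x ⊔ score j g)) where

    -- The property `P` survives every update of the best value; it will say that this value is a
    -- feasible load.
    Good : Store → Set
    Good σ = cells σ ≡ matrix × regs σ 0 ≡ n × P (regs σ 6)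

    -- The guesses from place `d` on are fixed by the outer loops; all bounded choices for the
    -- places before `d` have been tried.
    Searched : ℕ → Store → Store → Set
    Searched d σ τ = regs σ 6 ≤ regs τ 6 × (∀ {r} → d ≤ r → regs τ (7 + r) ≡ regs σ (7 + r)) ×
      (∀ g → (∀ {r} → r < d → g r ≤ n) → (∀ {r} → d ≤ r → g r ≡ regs σ (7 + r)) → score j g ≤ regs τ 6)

    search-spec : ∀ d {σ} → Good σ → Terminates (search j d) σ (searchCost j d n) λ τ → Good τ × Searched d σ τ
    search-spec zero {σ} (cells≡ , r₀≡ , Pσ)
      with τ , t , p⇓ , t≤ , (cells≡′ , r₀≡′ , frame) , r₆≡
             ← evaluate-spec j (λ r → regs σ (7 + r)) (cells≡ , r₀≡ , λ _ → refl) =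
      τ , t , p⇓ , t≤ , (cells≡′ , r₀≡′ , subst P (sym r₆≡) (P-⊔ _ Pσ)) ,
      ≤-trans (m≤m⊔n _ _) (≤-reflexive (sym r₆≡)) , (λ {r} _ → frame r) ,
      λ g _ g≗ → ≤-trans (≤-reflexive (minScore-cong j j λ _ → g≗ z≤n))
        (≤-trans (m≤n⊔m (regs σ 6) _) (≤-reflexive (sym r₆≡)))
    search-spec (suc d) {σ} (cells≡ , r₀≡ , Pσ) =
      finish (for-rule (suc n) _ Inv (λ { (c , (_ , r₀≡ , _) , _) → cong suc r₀≡ , c }) body {σ} start)
      where
      Inv : ℕ → Store → Set
      Inv i τ = regs τ (7 + d) ≡ i × Good τ × regs σ 6 ≤ regs τ 6 ×
        (∀ {r} → suc d ≤ r → regs τ (7 + r) ≡ regs σ (7 + r)) ×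
        (∀ g → (∀ {r} → r < suc d → g r ≤ n) → (∀ {r} → suc d ≤ r → g r ≡ regs σ (7 + r)) →
         g d < i → score j g ≤ regs τ 6)

      set : ∀ f r {x} → (f [ r ↦ x ]) r ≡ x
      set f r with r ≟ r
      ... | yes _  = refl
      ... | no r≢r = contradiction refl r≢r

      keep : ∀ f {r s x} → r ≢ s → (f [ r ↦ x ]) s ≡ f s
      keep f {r} {s} r≢s with r ≟ s
      ... | yes r≡s = contradiction r≡s r≢s
      ... | no  _   = refl

      ≢7+ : ∀ {r} → suc d ≤ r → 7 + d ≢ 7 + r
      ≢7+ d<r = <⇒≢ (+-monoʳ-< 7 d<r)

      store-keeps : ∀ {τ i x} → Good τ → regs σ 6 ≤ regs τ 6 →
        (∀ {r} → suc d ≤ r → regs τ (7 + r) ≡ regs σ (7 + r)) →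
        (∀ g → (∀ {r} → r < suc d → g r ≤ n) → (∀ {r} → suc d ≤ r → g r ≡ regs σ (7 + r)) →
         g d < i → score j g ≤ regs τ 6) → x ≡ i →
        Inv i (store (regs τ [ 7 + d ↦ x ]) (cells τ))
      store-keeps {τ} (cells≡ , r₀≡ , Pτ) best frame tried refl =
        set (regs τ) (7 + d) , (cells≡ , r₀≡ , Pτ) , best ,
        (λ d<r → trans (keep (regs τ) (≢7+ d<r)) (frame d<r)) , tried

      start : Inv 0 (store (regs σ [ 7 + d ↦ 0 ]) (cells σ))
      start = store-keeps (cells≡ , r₀≡ , Pσ) ≤-refl (λ _ → refl) (λ _ _ _ ()) refl

      body : ∀ {i τ} → i < suc n → Inv i τ → Terminates (search j d) τ (searchCost j d n)
        λ υ → Inv (suc i) (store (regs υ [ 7 + d ↦ regs υ (7 + d) + 1 ]) (cells υ))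
      body {i} {τ} i≤n (rd≡ , good , best , frame , tried)
        with υ , t , p⇓ , t≤ , good′ , best′ , frame′ , tried′ ← search-spec d good =
        υ , t , p⇓ , t≤ , store-keeps good′ (≤-trans best best′)
          (λ d<r → trans (frame′ (<⇒≤ d<r)) (frame d<r)) more
          (trans (cong (_+ 1) (trans (frame′ ≤-refl) rd≡)) (+-comm i 1))
        where
        more : ∀ g → (∀ {r} → r < suc d → g r ≤ n) → (∀ {r} → suc d ≤ r → g r ≡ regs σ (7 + r)) →
               g d < suc i → score j g ≤ regs υ 6
        more g g≤n g≗ gd<1+i with m≤n⇒m<n∨m≡n (s≤s⁻¹ gd<1+i)
        -- Either the guess was tried in an earlier round, or it agrees with the registers from
        -- place `d` on and the inner search covers it.
        ... | inj₁ gd<i = ≤-trans (tried g g≤n g≗ gd<i) best′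
        ... | inj₂ gd≡i = tried′ g (g≤n ∘ m<n⇒m<1+n) λ d≤r → agree (m≤n⇒m<n∨m≡n d≤r)
          where
          agree : ∀ {r} → d < r ⊎ d ≡ r → g r ≡ regs τ (7 + r)
          agree (inj₁ d<r)  = trans (g≗ d<r) (sym (frame d<r))
          agree (inj₂ refl) = trans gd≡i (sym rd≡)

      finish : ∀ {p B} → Terminates p σ B (Inv (suc n)) →
               Terminates p σ B λ τ → Good τ × Searched (suc d) σ τ
      finish (τ , t , p⇓ , t≤ , _ , good , best , frame , tried) =
        τ , t , p⇓ , t≤ , good , best , frame , λ g g≤n g≗ → tried g g≤n g≗ (s≤s (g≤n ≤-refl))

-- Polynomial running time

-- Powers of `suc n` grow with the exponent even for `n = 0`, so that two bounds can be added.
PolyBounded : (ℕ → ℕ) → Set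
PolyBounded f = ∃[ C ] ∃[ e ] ∀ n → f n ≤ C * suc n ^ e

poly-const : ∀ k → PolyBounded (const k)
poly-const k = k , 0 , λ _ → ≤-reflexive (sym (*-identityʳ k))

poly-id : PolyBounded id
poly-id = 1 , 1 , λ n → ≤-trans (n≤1+n n) (≤-reflexive (sym (trans (*-identityˡ _) (*-identityʳ (suc n)))))

poly-+ : ∀ {f g} → PolyBounded f → PolyBounded g → PolyBounded (λ n → f n + g n)
poly-+ {f} {g} (C , d , f≤) (D , e , g≤) = C + D , d + e , λ n → begin
  f n + g n                                    ≤⟨ +-mono-≤ (f≤ n) (g≤ n) ⟩
  C * suc n ^ d + D * suc n ^ e                ≤⟨ +-mono-≤ (*-monoʳ-≤ C (^-monoʳ-≤ (suc n) (m≤m+n d e)))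
                                                           (*-monoʳ-≤ D (^-monoʳ-≤ (suc n) (m≤n+m e d))) ⟩
  C * suc n ^ (d + e) + D * suc n ^ (d + e)    ≡⟨ *-distribʳ-+ (suc n ^ (d + e)) C D ⟨
  (C + D) * suc n ^ (d + e)                    ∎
  where open ≤-Reasoning

poly-* : ∀ {f g} → PolyBounded f → PolyBounded g → PolyBounded (λ n → f n * g n)
poly-* {f} {g} (C , d , f≤) (D , e , g≤) = C * D , d + e , λ n → begin
  f n * g n                            ≤⟨ *-mono-≤ (f≤ n) (g≤ n) ⟩
  C * suc n ^ d * (D * suc n ^ e)      ≡⟨ [m*n]*[o*p]≡[m*o]*[n*p] C (suc n ^ d) D (suc n ^ e) ⟩
  C * D * (suc n ^ d * suc n ^ e)      ≡⟨ cong (C * D *_) (^-distribˡ-+-* (suc n) d e) ⟨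
  C * D * suc n ^ (d + e)              ∎
  where open ≤-Reasoning

poly-for : ∀ {L B} e → PolyBounded L → PolyBounded B → PolyBounded (λ n → forCost (L n) e (B n))
poly-for e pL pB = poly-+ (poly-const 2)
  (poly-+ (poly-* pL (poly-+ pB (poly-const (cost e + 7)))) (poly-const (cost e + 3)))

poly-count : ∀ j i → PolyBounded (countCost j i)
poly-count j i = poly-+ (poly-const 2) (poly-+ (poly-const 2)
  (poly-for (reg 0) poly-id (poly-for (reg 0) poly-id (poly-const (suc (cost (reg 4 ⊕ edgeE j i)) + 4)))))

poly-min : ∀ j i → PolyBounded (minCost j i)
poly-min j zero    = poly-+ (poly-count j 0) (poly-const 2)
poly-min j (suc i) = poly-+ (poly-min j i) (poly-+ (poly-count j (suc i)) (poly-const 6))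

poly-search : ∀ j d → PolyBounded (searchCost j d)
poly-search j zero    = poly-+ (poly-min j j) (poly-const 6)
poly-search j (suc d) = poly-for (lit 1 ⊕ reg 0) (poly-+ (poly-const 1) poly-id) (poly-search j d)

-- For positive `n` one has `suc n ≤ 2 * n`, whence the factor `2 ^ e`; the summand `C` is for
-- `n = 0`.
polyBound : ∀ {f} → PolyBounded f → ∃[ a ] ∃[ d ] ∃[ b ] ∀ n → f n ≤ a * n ^ d + b
polyBound {f} (C , e , f≤) = C * 2 ^ e , e , C , bound
  where
  open ≤-Reasoning
  ^-distribʳ-* : ∀ m n e → (m * n) ^ e ≡ m ^ e * n ^ e
  ^-distribʳ-* m n zero    = refl
  ^-distribʳ-* m n (suc e) =
    trans (cong (m * n *_) (^-distribʳ-* m n e)) ([m*n]*[o*p]≡[m*o]*[n*p] m n (m ^ e) (n ^ e))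
  bound : ∀ n → f n ≤ C * 2 ^ e * n ^ e + C
  bound zero = begin
    f 0                          ≤⟨ f≤ 0 ⟩
    C * 1 ^ e                    ≡⟨ trans (cong (C *_) (^-zeroˡ e)) (*-identityʳ C) ⟩
    C                            ≤⟨ m≤n+m C _ ⟩
    C * 2 ^ e * 0 ^ e + C        ∎
  bound n@(suc m) = begin
    f n                          ≤⟨ f≤ n ⟩
    C * suc n ^ e                ≤⟨ *-monoʳ-≤ C (^-monoˡ-≤ e (+-monoˡ-≤ n (s≤s (z≤n {m})))) ⟩
    C * (n + n) ^ e              ≡⟨ cong (λ x → C * x ^ e) (cong (λ y → n + y) (+-identityʳ n)) ⟨
    C * (2 * n) ^ e              ≡⟨ cong (C *_) (^-distribʳ-* 2 n e) ⟩
    C * (2 ^ e * n ^ e)          ≡⟨ *-assoc C (2 ^ e) (n ^ e) ⟨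
    C * 2 ^ e * n ^ e            ≤⟨ m≤m+n _ C ⟩
    C * 2 ^ e * n ^ e + C        ∎

-- The ratio as a rational number

module _ where
  open import Data.Integer.Base using (+_)

  fromℕ-* : ∀ m n → fromℕ (m * n) ≡ fromℕ m ℚ.* fromℕ n
  fromℕ-* m n = ℚ.toℚᵘ-injective (begin
    toℚᵘ (fromℕ (m * n))                     ≈⟨ ℚ.toℚᵘ-fromℚᵘ (mkℚᵘ (+ (m * n)) 0) ⟩
    mkℚᵘ (+ (m * n)) 0                       ≡⟨ cong (λ x → mkℚᵘ x 0) (ℤ.pos-* m n) ⟩
    mkℚᵘ (+ m) 0 ℚᵘ.* mkℚᵘ (+ n) 0           ≈⟨ ℚᵘ.*-cong
                                                    (ℚ.toℚᵘ-fromℚᵘ (mkℚᵘ (+ m) 0)) (ℚ.toℚᵘ-fromℚᵘ (mkℚᵘ (+ n) 0)) ⟨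
    toℚᵘ (fromℕ m) ℚᵘ.* toℚᵘ (fromℕ n)       ≈⟨ ℚ.toℚᵘ-homo-* (fromℕ m) (fromℕ n) ⟨
    toℚᵘ (fromℕ m ℚ.* fromℕ n)               ∎)
    where open ℚᵘ.≃-Reasoning

  fromℕ-mono : ∀ {m n} → m ≤ n → fromℕ m ℚ.≤ fromℕ n
  fromℕ-mono {m} {n} m≤n = ℚ.toℚᵘ-cancel-≤ (begin
    toℚᵘ (fromℕ m)   ≃⟨ ℚ.toℚᵘ-fromℚᵘ (mkℚᵘ (+ m) 0) ⟩
    mkℚᵘ (+ m) 0     ≤⟨ ℚᵘ.*≤* (ℤ.*-monoʳ-≤-nonNeg (+ 1) (ℤ.+≤+ m≤n)) ⟩
    mkℚᵘ (+ n) 0     ≃⟨ ℚ.toℚᵘ-fromℚᵘ (mkℚᵘ (+ n) 0) ⟨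
    toℚᵘ (fromℕ n)   ∎)
    where open ℚᵘ.≤-Reasoning

  -- The quotient is the integer `16 * i - 6` for `i = 2 + j`, so that the ratio can be treated as a
  -- natural number.
  K/i : ∀ j → K (2 + j) ℚ./ (2 + j) ≡ fromℕ (16 * j + 26)
  K/i j = ℚ.fromℚᵘ-cong {mkℚᵘ (K i) (suc j)} {mkℚᵘ (+ x) 0} (ℚᵘ.*≡* (begin
    K i ℤ.* + 1                                    ≡⟨ ℤ.*-identityʳ (K i) ⟩
    + 16 ℤ.* + (i ^ 2) ℤ.- + 6 ℤ.* + i             ≡⟨ cong₂ ℤ._-_ (sym (ℤ.pos-* 16 (i ^ 2))) (sym (ℤ.pos-* 6 i)) ⟩
    + (16 * i ^ 2) ℤ.- + (6 * i)                   ≡⟨ cong (λ y → + y ℤ.- + (6 * i)) (lemma j) ⟩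
    + (x * i + 6 * i) ℤ.- + (6 * i)                ≡⟨ cong (ℤ._- + (6 * i)) (ℤ.pos-+ (x * i) (6 * i)) ⟩
    + (x * i) ℤ.+ + (6 * i) ℤ.- + (6 * i)          ≡⟨ ℤ.+-assoc (+ (x * i)) (+ (6 * i)) (ℤ.- + (6 * i)) ⟩
    + (x * i) ℤ.+ (+ (6 * i) ℤ.- + (6 * i))        ≡⟨ cong (λ y → + (x * i) ℤ.+ y) (ℤ.+-inverseʳ (+ (6 * i))) ⟩
    + (x * i) ℤ.+ + 0                              ≡⟨ ℤ.+-identityʳ (+ (x * i)) ⟩
    + (x * i)                                      ≡⟨ ℤ.pos-* x i ⟩
    + x ℤ.* + i                                    ∎))
    where
    open ≡-Reasoning
    i x : ℕ
    i = 2 + j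
    x = 16 * j + 26
    lemma : ∀ j → 16 * ((2 + j) * ((2 + j) * 1)) ≡ (16 * j + 26) * (2 + j) + 6 * (2 + j)
    lemma = solve-∀

-- Each further colour brings one factor 2 and one factor K(i)/i, together `32 * j + 52`.
ratio≡ : ∀ j → fromℕ (2 ^ j) ℚ.* P (suc j) ≡ fromℕ (ratio j)
ratio≡ zero    = refl
ratio≡ (suc j) = begin
  fromℕ (2 ^ suc j) ℚ.* (P (suc j) ℚ.* (K (2 + j) ℚ./ (2 + j)))
    ≡⟨ cong₂ (λ x y → x ℚ.* (P (suc j) ℚ.* y))
         (trans (cong fromℕ (*-comm 2 (2 ^ j))) (fromℕ-* (2 ^ j) 2)) (K/i j) ⟩
  (fromℕ (2 ^ j) ℚ.* fromℕ 2) ℚ.* (P (suc j) ℚ.* fromℕ (16 * j + 26))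
    ≡⟨ interchange (CommutativeMonoid.commutativeSemigroup ℚ.*-1-commutativeMonoid)
         (fromℕ (2 ^ j)) (fromℕ 2) (P (suc j)) (fromℕ (16 * j + 26)) ⟩
  (fromℕ (2 ^ j) ℚ.* P (suc j)) ℚ.* (fromℕ 2 ℚ.* fromℕ (16 * j + 26))
    ≡⟨ cong₂ ℚ._*_ (ratio≡ j) (sym (fromℕ-* 2 (16 * j + 26))) ⟩
  fromℕ (ratio j) ℚ.* fromℕ (2 * (16 * j + 26))
    ≡⟨ fromℕ-* (ratio j) (2 * (16 * j + 26)) ⟨
  fromℕ (ratio j * (2 * (16 * j + 26)))
    ≡⟨ cong fromℕ (trans (cong (ratio j *_) (lemma j)) (*-comm (ratio j) _)) ⟩
  fromℕ (ratio (suc j))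
    ∎
  where
  open ≡-Reasoning
  lemma : ∀ j → 2 * (16 * j + 26) ≡ 32 * j + 52
  lemma = solve-∀

-- The algorithm and its guarantee

approximate : ℕ → Program
approximate j = search j (j * 4) ⨾ 0 := reg 6

module _ (j : ℕ) {n : ℕ} (G : Graph n) where

  A : ℕ → ℕ → Bool
  A = adjacent G

  adjacency : IsAdjacency A
  adjacency = adjacent-isAdjacency G

  loads : (ℕ → ℕ) → ℕ → ℕ
  loads g i = loadBelow n A (level (colour j g) i)

  minimum : (ℕ → ℕ) → ℕ
  minimum = score n A (adjacencyMatrix G) (adjacencyMatrix-adjacent G) j

  lcp-minimum : ∀ g → LCP (suc j) (minimum g) G
  lcp-minimum g = φ , λ i → subst (minimum g ≤_)
    (sym (load≡loadBelow G φ (colour j g) (λ u → Fin.toℕ-fromℕ< (s≤s (colour≤ j g (toℕ u)))) i))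
    (minScore≤ n A (adjacencyMatrix G) (adjacencyMatrix-adjacent G) j g (s≤s⁻¹ (Fin.toℕ<n i)))
    where
    φ : Fin n → Fin (suc j)
    φ u = fromℕ< (s≤s (colour≤ j g (toℕ u)))

  lcp-⊔ : ∀ {x} g → LCP (suc j) x G → LCP (suc j) (x ⊔ minimum g) G
  lcp-⊔ {x} g lcp with ⊔-sel x (minimum g)
  ... | inj₁ eq = subst (λ k → LCP (suc j) k G) (sym eq) lcp
  ... | inj₂ eq = subst (λ k → LCP (suc j) k G) (sym eq) (lcp-minimum g)

  extendℕ : (Fin n → Fin (suc j)) → ℕ → ℕ
  extendℕ φ u with u <? n
  ... | yes u<n = toℕ (φ (fromℕ< u<n))
  -- Vertices from `n` on are never counted, so the value is arbitrary.
  ... | no  _   = 0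

  extendℕ-toℕ : ∀ φ u → toℕ (φ u) ≡ extendℕ φ (toℕ u)
  extendℕ-toℕ φ u with toℕ u <? n
  ... | yes u<n = cong (toℕ ∘ φ) (sym (Fin.fromℕ<-toℕ u u<n))
  ... | no  u≮n = contradiction (Fin.toℕ<n u) u≮n

  -- The target is doubled because arcs count every edge twice, and the factor 2 is cancelled at the
  -- end. The least load is one of the loads, so the bound for each colour carries over to it.
  good-guess : ∀ k → 0 < k → LCP (suc j) k G → ∃[ g ] Bounded n g × k ≤ ratio j * minimum g
  good-guess k 0<k (φ , k≤) =
    let g , g≤n , dense = approximation n j adjacency (2 * k) (≤-trans 0<k (m≤m+n k _)) ψ ψ-dense
    in g , g≤n , minScore-attained n A (adjacencyMatrix G) (adjacencyMatrix-adjacent G) j j g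
         (λ l → k ≤ ratio j * l) λ {i} i≤j → *-cancelˡ-≤ 2 (begin
           2 * k                                       ≤⟨ dense i≤j ⟩
           ratio j * Arcs.arcs n A (level (colour j g) i)
             ≡⟨ cong (ratio j *_) (arcs≡2*loadBelow n adjacency (level (colour j g) i)) ⟩
           ratio j * (2 * loads g i)                   ≡⟨ lemma (ratio j) 2 (loads g i) ⟩
           2 * (ratio j * loads g i)                   ∎)
    where
    open ≤-Reasoning
    lemma : ∀ a b c → a * (b * c) ≡ b * (a * c)
    lemma = solve-∀
    ψ : ℕ → ℕ
    ψ = extendℕ φ
    ψ-dense : Dense n A 1 ψ j (2 * k)
    ψ-dense {i} i≤j = begin
      2 * k                                 ≤⟨ *-monoʳ-≤ 2 (k≤ (fromℕ< (s≤s i≤j))) ⟩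
      2 * load G φ (fromℕ< (s≤s i≤j))       ≡⟨ cong (2 *_) (load≡loadBelow G φ ψ (extendℕ-toℕ φ) (fromℕ< (s≤s i≤j))) ⟩
      2 * loadBelow n A (level ψ (toℕ (fromℕ< (s≤s i≤j))))
        ≡⟨ cong (λ x → 2 * loadBelow n A (level ψ x)) (Fin.toℕ-fromℕ< (s≤s i≤j)) ⟩
      2 * loadBelow n A (level ψ i)         ≡⟨ arcs≡2*loadBelow n adjacency (level ψ i) ⟨
      Arcs.arcs n A (level ψ i)             ≡⟨ *-identityˡ _ ⟨
      1 * Arcs.arcs n A (level ψ i)         ∎

  approximate-spec : Terminates (approximate j) (input G) (searchCost j (j * 4) n + 2) λ τ →
    LCP (suc j) (regs τ 0) G × (∀ k → LCP (suc j) k G → k ≤ ratio j * regs τ 0)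
  approximate-spec = seq
    -- The best value starts at 0, which every colouring attains.
    (search-spec n A (adjacencyMatrix G) (adjacencyMatrix-adjacent G) j
      (λ k → LCP (suc j) k G) lcp-⊔ (j * 4) (refl , refl , (const Fin.zero , λ _ → z≤n)))
    λ { {τ} ((_ , _ , lcp) , (_ , _ , tried)) → assign (lcp , λ k → best τ tried k (k ≟ 0)) }
    where
    open ≤-Reasoning
    -- The search leaves the guess registers from place `j * 4` on at their initial value 0, so a
    -- guess is cut off there to agree with them; its colouring does not change.
    truncate : (ℕ → ℕ) → ℕ → ℕ
    truncate g r with r <? j * 4
    ... | yes _ = g r
    ... | no  _ = 0
    truncate≤n : ∀ {g} → Bounded n g → ∀ {r} → r < j * 4 → truncate g r ≤ n
    truncate≤n g≤n {r} _ with r <? j * 4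
    ... | yes _ = g≤n r
    ... | no  _ = z≤n
    truncate≡0 : ∀ g {r} → j * 4 ≤ r → truncate g r ≡ 0
    truncate≡0 g {r} j4≤r with r <? j * 4
    ... | yes r<j4 = contradiction j4≤r (<⇒≱ r<j4)
    ... | no  _    = refl
    truncate≡g : ∀ g {r} → r < j * 4 → g r ≡ truncate g r
    truncate≡g g {r} r<j4 with r <? j * 4
    ... | yes _    = refl
    ... | no  r≮j4 = contradiction r<j4 r≮j4
    best : ∀ τ → (∀ g → (∀ {r} → r < j * 4 → g r ≤ n) → (∀ {r} → j * 4 ≤ r → g r ≡ 0) → minimum g ≤ regs τ 6) →
           ∀ k → Dec (k ≡ 0) → LCP (suc j) k G → k ≤ ratio j * regs τ 6
    best τ tried k (yes refl) _   = z≤n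
    best τ tried k (no k≢0)   lcp =
      let g , g≤n , k≤ = good-guess k (n≢0⇒n>0 k≢0) lcp
      in begin
        k                                  ≤⟨ k≤ ⟩
        ratio j * minimum g                ≡⟨ cong (ratio j *_) (minScore-cong n A (adjacencyMatrix G)
                                                (adjacencyMatrix-adjacent G) j j (truncate≡g g)) ⟩
        ratio j * minimum (truncate g)     ≤⟨ *-monoʳ-≤ (ratio j) (tried (truncate g) (truncate≤n g≤n) (truncate≡0 g)) ⟩
        ratio j * regs τ 6                 ∎

theorem3 : (c : ℕ) .{{_ : NonZero c}} →
    ∃ (IsApproximationAlgorithm c (fromℕ (2 ^ (c ∸ 1)) ℚ.* P c))
theorem3 (suc j) =
  let a , d , b , cost≤ = polyBound (poly-+ (poly-search j (j * 4)) (poly-const 2))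
  in approximate j , a , d , b , λ {n} G →
    let τ , t , run , t≤ , lcp , best = approximate-spec j G
    in regs τ 0 , (τ , t , run , refl , ≤-trans t≤ (cost≤ n)) , lcp ,
       subst (fromℕ (kₒₚₜ (suc j) G) ℚ.≤_)
         (trans (fromℕ-* (ratio j) (regs τ 0)) (cong (ℚ._* fromℕ (regs τ 0)) (sym (ratio≡ j))))
         (fromℕ-mono (best (kₒₚₜ (suc j) G) (proj₁ (proj₂ (maxLoad (suc j) G)))))
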